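{- Let $G$ be a finite abelian group. For every sequence $(g_k)_{k=1}^{|G|}$ of $|G|$ elements of $G$ there is a nonempty subsequence $(g_k)_{k\in K}$ (with $\emptyset\neq K\subseteq\{1,\dots,|G|\}$) such that $\sum_{k\in K}g_k=0_G$ and $\sum_{k\in K}1/|g_k|\le 1$.
   Context: Here $|G|$ denotes the order of $G$, $0_G$ its identity element, and $|g|$ denotes the order of an element $g\in G$. Sequences may contain repeated elements. -}

module Defs where

open import Level using (Level)
open import Data.Nat using (ℕ; zero; suc; _<_)
open import Data.Integer using (+_)
open import Data.Rational using (ℚ; _/_; _+_; 0ℚ)
open import Data.Bool using (Bool; true; false; if_then_else_)
open import Data.Fin using (Fin; zero; suc)
open import Data.Product using (∃; _×_)
open import Relation.Nullary using (¬_)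
open import Algebra.Bundles using (AbelianGroup)

module _ {c ℓ : Level} (G : AbelianGroup c ℓ) where
  open AbelianGroup G

  _•_ : ℕ → Carrier → Carrier
  zero  • g = ε
  suc k • g = g ∙ (k • g)

  IsOrderOf : Carrier → ℕ → Set ℓ
  IsOrderOf g m = (0 < m) × (m • g ≈ ε) × (∀ k → 0 < k → k < m → ¬ (k • g ≈ ε))

  IsEnumeration : (n : ℕ) → (Fin n → Carrier) → Set (c Level.⊔ ℓ)
  IsEnumeration n e =
    (∀ i j → e i ≈ e j → i ≡ j) × (∀ x → ∃ λ i → e i ≈ x)
    where open import Relation.Binary.PropositionalEquality using (_≡_)

  subsetSum : ∀ {n} → (Fin n → Bool) → (Fin n → Carrier) → Carrier
  subsetSum {zero}  K g = ε
  subsetSum {suc n} K g =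
    (if K zero then g zero else ε) ∙ subsetSum (λ i → K (suc i)) (λ i → g (suc i))

-- 1/m as a rational (m > 0 in all uses; 1/0 := 0 is never used)
recip : ℕ → ℚ
recip zero    = 0ℚ
recip (suc m) = (+ 1) / suc m

subsetSumℚ : ∀ {n} → (Fin n → Bool) → (Fin n → ℚ) → ℚ
subsetSumℚ {zero}  K q = 0ℚ
subsetSumℚ {suc n} K q =
  (if K zero then q zero else 0ℚ) + subsetSumℚ (λ i → K (suc i)) (λ i → q (suc i))

{-# OPTIONS --safe #-}
module Submission where

-- A pebbling argument in the style of Lemke–Kleitman and Chung.  A pebble on a cyclic subgroup C
-- is a nonempty set K of indices with ∑_{k∈K} g_k ∈ C and ∑_{k∈K} 1/|g_k| ≤ 1/|C|; initially each
-- k is a pebble on ⟨g_k⟩, and a pebble on the trivial subgroup is what we want.  If p is a prime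
-- and C′ ≤ C has index p, then among p pebbles on C some have a union that is a pebble on C′,
-- because p elements of C/C′ ≅ ℤ/p have a nonempty zero-sum subset.  The cyclic subgroups of G
-- form a product, over the primes p, of trees T_p (those of the p-primary part), so it suffices to
-- reach the root of such a product from any M pebbles, where M = ∏_p |G_p| ≤ |G|.
--
-- Let A be the number of pebbles and q the number of occupied vertices.  One proves together that
-- A ≥ M gives one pebble at the root and that A + q > 2M gives two, adding the leaves of one tree
-- at a time.  With a leaf x of depth d + 1 above y, consider the pebbles in the slice over x.
-- If A + q > p^(d+1) M in that slice, enough of them can be gathered at x itself to send one down to
-- the root; otherwise pushing all p-tuples from x to y loses at most (p - 1) p^d M pebbles, which is
-- what the leaf contributes to the count.  The second statement needs 2V ≤ M + 1 for the V vertices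
-- of the other factors; this holds when those primes are odd, so the prime 2 is added last.

open import Defs
open import Level using (Level; _⊔_; 0ℓ; Lift; lift; lower) renaming (suc to lsuc)
open import Algebra.Bundles using (AbelianGroup; CommutativeMonoid)
import Algebra.Properties.AbelianGroup as AbelianGroupProperties
import Algebra.Properties.CommutativeMonoid.Mult as CMMult
import Algebra.Properties.CommutativeMonoid.Sum as CMSum
import Algebra.Properties.CommutativeSemigroup as CommutativeSemigroupProperties
open import Data.Bool using (Bool; true; false; if_then_else_)
open import Data.Fin using (Fin; zero; suc; toℕ; fromℕ<; combine)
import Data.Fin as Fin
open import Data.Fin.Properties using (injective⇒≤; pigeonhole; any?; toℕ-fromℕ<; toℕ<n; toℕ-injective; combine-injective; toℕ-combine; _≟_; +↔⊎; *↔×; 1↔⊤)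
import Data.Integer as ℤ
import Data.Integer.Properties as ℤₚ
open import Data.List using (List; []; _∷_)
open import Data.List.Relation.Unary.All using (_∷_)
open import Data.Nat using (ℕ; zero; suc; pred; _+_; _*_; _∸_; _^_; _≤_; _<_; z≤n; s≤s; NonZero; >-nonZero; >-nonZero⁻¹; nonTrivial⇒n>1)
import Data.Nat as ℕ
import Data.Nat.Coprimality as Coprimality
open import Data.Nat.Coprimality using (Coprime; coprime-Bézout; coprime-divisor)
open import Data.Nat.DivMod using (_/_; _%_; m≡m%n+[m/n]*n; m%n<n; _mod_)
open import Data.Nat.Divisibility
open import Data.Nat.GCD using (module Bézout)
open import Data.Nat.Induction using (<-rec)
open import Data.Nat.ListAction using (product)
open import Data.Nat.Primality using (Prime; prime[2]; ¬prime[0]; ¬prime[1]; prime⇒nonZero; prime⇒nonTrivial; prime⇒irreducible)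
open import Data.Nat.Primality.Factorisation using (factorise)
open import Data.Nat.Properties hiding (_≟_)
open import Data.Nat.Tactic.RingSolver using (solve-∀)
open import Data.Product using (∃; _×_; _,_; proj₁; proj₂; Σ)
open import Data.Product.Function.NonDependent.Propositional using (_×-↔_)
open import Data.Rational using (0ℚ; 1ℚ; toℚᵘ) renaming (_≤_ to _≤ℚ_; _+_ to _+ℚ_)
open import Data.Rational.Properties using (toℚᵘ-homo-+; toℚᵘ-fromℚᵘ; toℚᵘ-cancel-≤)
open import Data.Rational.Unnormalised using (mkℚᵘ; *≡*; *≤*; _≃_) renaming (_+_ to _+ᵘ_)
import Data.Rational.Unnormalised.Properties as ℚᵘₚ
open import Data.Sum using (_⊎_; inj₁; inj₂)
open import Data.Sum.Function.Propositional using (_⊎-↔_)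
open import Data.Unit using (⊤; tt)
open import Function using (_∘_)
open import Function.Bundles using (_↔_; module Inverse; module Injection)
open import Function.Construct.Composition using (_↔-∘_)
open import Function.Properties.Inverse using (↔⇒↣)
open import Relation.Binary using (Rel)
import Relation.Binary.Reasoning.Setoid as SetoidReasoning
open import Relation.Nullary using (¬_; yes; no; Dec; contradiction)
open import Relation.Nullary.Decidable using (map′; _×-dec_)
open import Relation.Binary.PropositionalEquality as ≡ using (_≡_; refl; cong; cong₂; subst)

-- Trees of cyclic subgroups, their products and their weighted size

-- The node added by _▹_ is numbered zero; older nodes are shifted by suc.
data Tree : ℕ → Set where
  root : Tree 1
  _▹_  : ∀ {k} → Tree k → Fin k → Tree (suc k)

rootOf : ∀ {k} → Tree k → Fin k
rootOf root    = zero
rootOf (t ▹ y) = suc (rootOf t)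

depth : ∀ {k} → Tree k → Fin k → ℕ
depth root    _       = 0
depth (t ▹ y) zero    = suc (depth t y)
depth (t ▹ y) (suc x) = depth t x

-- With p = suc u, a cyclic group of order p^(d+1) has u * p^d generators, so that size counts the
-- elements of a p-group whose cyclic subgroups form the tree.
size : ∀ {k} → ℕ → Tree k → ℕ
size u root    = 1
size u (t ▹ y) = size u t + u * suc u ^ depth t y

record Factor : Set where
  constructor factor
  field
    u    : ℕ   -- the prime of the factor is suc u
    {k}  : ℕ
    tree : Tree k

Vertex : List Factor → Set
Vertex []       = ⊤
Vertex (F ∷ fs) = Fin (Factor.k F) × Vertex fs

origin : ∀ fs → Vertex fs
origin []       = tt
origin (F ∷ fs) = rootOf (Factor.tree F) , origin fs

Num : List Factor → ℕ
Num []       = 1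
Num (F ∷ fs) = size (Factor.u F) (Factor.tree F) * Num fs

-- The Kronecker delta is natural-valued so that it can act as a multiplicity in any commutative
-- monoid; `sum-δ` then serves configurations, assertions and group elements alike.
δ : ∀ {k} → Fin k → Fin k → ℕ
δ zero    zero    = 1
δ zero    (suc j) = 0
δ (suc i) zero    = 0
δ (suc i) (suc j) = δ i j

-- Finite sums in commutative monoids, and preorders compatible with them

module SumLemmas {a b} (M : CommutativeMonoid a b) where
  open CommutativeMonoid M
    using (Carrier; _≈_)
    renaming (ε to 0#; refl to ≈-refl; trans to ≈-trans;
              ∙-cong to ⊕-cong; identityˡ to ⊕-identityˡ; identityʳ to ⊕-identityʳ)
  open CMSum M using (sum; sum-cong-≋; sum-replicate-zero)
  open CMMult M using (×-homo-1) renaming (_×_ to _·_)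

  sum-0 : ∀ {n} {f : Fin n → Carrier} → (∀ i → f i ≈ 0#) → sum f ≈ 0#
  sum-0 {n} h = ≈-trans (sum-cong-≋ h) (sum-replicate-zero n)

  sum-δ : ∀ {n} (y : Fin n) (f : Fin n → Carrier) → sum (λ i → δ y i · f i) ≈ f y
  sum-δ {suc n} zero f = ≈-trans (⊕-cong (×-homo-1 _) (sum-0 {n} λ _ → ≈-refl)) (⊕-identityʳ _)
  sum-δ (suc y) f = ≈-trans (⊕-identityˡ _) (sum-δ y (f ∘ suc))

-- x ⊢ y reads: the multiset of pebbles x can be turned into y, where pebbles may be thrown away.
record AffineMonoid a b r : Set (lsuc (a ⊔ b ⊔ r)) where
  field
    commutativeMonoid : CommutativeMonoid a b
  open CommutativeMonoid commutativeMonoid public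
    using (Carrier; _≈_)
    renaming (_∙_ to _⊕_; ε to 0#; refl to ≈-refl; sym to ≈-sym; trans to ≈-trans;
              ∙-cong to ⊕-cong; identityˡ to ⊕-identityˡ; identityʳ to ⊕-identityʳ;
              assoc to ⊕-assoc; comm to ⊕-comm)
  field
    _⊢_       : Rel Carrier r
    reflexive : ∀ {x y} → x ≈ y → x ⊢ y
    ⊢-trans   : ∀ {x y z} → x ⊢ y → y ⊢ z → x ⊢ z
    ⊕-mono    : ∀ {x x′ y y′} → x ⊢ x′ → y ⊢ y′ → (x ⊕ y) ⊢ (x′ ⊕ y′)
    discard   : ∀ x → x ⊢ 0#
  open CMSum commutativeMonoid public using (sum; sum-cong-≋; ∑-distrib-+)
  open SumLemmas commutativeMonoid public
  open CMMult commutativeMonoid public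
    using (×-congʳ; ×-congˡ; ×-homo-1; ×-homo-+; ×-assocˡ; ×-distrib-+)
    renaming (_×_ to _·_)

  infixr 5 _⟫_
  _⟫_ : ∀ {x y z} → x ⊢ y → y ⊢ z → x ⊢ z
  _⟫_ = ⊢-trans

  ⊢-refl : ∀ {x} → x ⊢ x
  ⊢-refl = reflexive ≈-refl

  dropʳ : ∀ {x y} → (x ⊕ y) ⊢ x
  dropʳ = ⊕-mono ⊢-refl (discard _) ⟫ reflexive (⊕-identityʳ _)

  ·-mono : ∀ n {x y} → x ⊢ y → (n · x) ⊢ (n · y)
  ·-mono zero    p = ⊢-refl
  ·-mono (suc n) p = ⊕-mono p (·-mono n p)

  ·-mono-≤ : ∀ {m n} x → m ≤ n → (n · x) ⊢ (m · x)
  ·-mono-≤ x z≤n       = discard _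
  ·-mono-≤ x (s≤s m≤n) = ⊕-mono ⊢-refl (·-mono-≤ x m≤n)

  sum-mono : ∀ {n} {f g : Fin n → Carrier} → (∀ i → f i ⊢ g i) → sum f ⊢ sum g
  sum-mono {zero}  h = ⊢-refl
  sum-mono {suc n} h = ⊕-mono (h zero) (sum-mono (h ∘ suc))

  ∑ : ∀ fs → (Vertex fs → Carrier) → Carrier
  ∑ []       f = f tt
  ∑ (F ∷ fs) f = sum (λ i → ∑ fs (λ v → f (i , v)))

  ∑-cong : ∀ fs {f g} → (∀ v → f v ≈ g v) → ∑ fs f ≈ ∑ fs g
  ∑-cong []       h = h tt
  ∑-cong (F ∷ fs) h = sum-cong-≋ (λ i → ∑-cong fs (λ v → h (i , v)))

  ∑-mono : ∀ fs {f g} → (∀ v → f v ⊢ g v) → ∑ fs f ⊢ ∑ fs g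
  ∑-mono []       h = h tt
  ∑-mono (F ∷ fs) h = sum-mono (λ i → ∑-mono fs (λ v → h (i , v)))

  ∑-⊕ : ∀ fs f g → ∑ fs (λ v → f v ⊕ g v) ≈ (∑ fs f ⊕ ∑ fs g)
  ∑-⊕ []       f g = ≈-refl
  ∑-⊕ (F ∷ fs) f g = ≈-trans (sum-cong-≋ {Factor.k F} (λ i → ∑-⊕ fs (λ v → f (i , v)) (λ v → g (i , v))))
                             (∑-distrib-+ (λ i → ∑ fs (λ v → f (i , v))) (λ i → ∑ fs (λ v → g (i , v))))

  ∑-0 : ∀ fs {f} → (∀ v → f v ≈ 0#) → ∑ fs f ≈ 0#
  ∑-0 []       h = h tt
  ∑-0 (F ∷ fs) h = sum-0 (λ i → ∑-0 fs (λ v → h (i , v)))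

  ∑-· : ∀ fs n f → ∑ fs (λ v → n · f v) ≈ (n · ∑ fs f)
  ∑-· fs zero    f = ∑-0 fs (λ _ → ≈-refl)
  ∑-· fs (suc n) f = ≈-trans (∑-⊕ fs _ _) (⊕-cong ≈-refl (∑-· fs n f))

ℕ-affine : AffineMonoid 0ℓ 0ℓ 0ℓ
ℕ-affine = record
  { commutativeMonoid = +-0-commutativeMonoid
  ; _⊢_       = λ m n → n ≤ m
  ; reflexive = λ { refl → ≤-refl }
  ; ⊢-trans   = λ p q → ≤-trans q p
  ; ⊕-mono    = +-mono-≤
  ; discard   = λ _ → z≤n
  }

private module 𝐍 = AffineMonoid ℕ-affine

-- Configurations of pebbles: totals, supports and selections

Config : List Factor → Set
Config fs = Vertex fs → ℕ

total : ∀ fs → Config fs → ℕ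
total = 𝐍.∑

·≡* : ∀ m n → m 𝐍.· n ≡ m * n
·≡* zero    n = refl
·≡* (suc m) n = cong (n +_) (·≡* m n)

total-* : ∀ fs n c → total fs (λ v → n * c v) ≡ n * total fs c
total-* fs n c = ≡.trans (𝐍.∑-cong fs (λ v → ≡.sym (·≡* n (c v))))
                (≡.trans (𝐍.∑-· fs n c) (·≡* n _))

sg : ℕ → ℕ
sg zero    = 0
sg (suc _) = 1

sg-mono : ∀ {m n} → m ≤ n → sg m ≤ sg n
sg-mono z≤n     = z≤n
sg-mono (s≤s _) = ≤-refl

sg≤ : ∀ m → sg m ≤ m
sg≤ zero    = z≤n
sg≤ (suc m) = s≤s z≤n

support : ∀ fs → Config fs → ℕ
support fs c = total fs (sg ∘ c)

∣V∣ : List Factor → ℕ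
∣V∣ fs = total fs (λ _ → 1)

sg≤1 : ∀ m → sg m ≤ 1
sg≤1 zero    = z≤n
sg≤1 (suc m) = ≤-refl

support≤∣V∣ : ∀ fs c → support fs c ≤ ∣V∣ fs
support≤∣V∣ fs c = 𝐍.∑-mono fs (λ v → sg≤1 (c v))

support≤total : ∀ fs c → support fs c ≤ total fs c
support≤total fs c = 𝐍.∑-mono fs (λ v → sg≤ (c v))

-- The choice is greedy: positions are filled from the left until `k` is used up.
choose-sum : ∀ {n} (f : Fin n → ℕ) k → k ≤ 𝐍.sum f →
             ∃ λ g → (∀ i → g i ≤ f i) × 𝐍.sum g ≡ k
choose-sum {zero}  f zero k≤ = f , (λ ()) , refl
choose-sum {suc n} f k    k≤ with ≤-total k (f zero)
... | inj₁ k≤f = (λ { zero → k ; (suc i) → 0 }) , (λ { zero → k≤f ; (suc i) → z≤n })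
               , ≡.trans (cong (k +_) (𝐍.sum-0 {n} (λ _ → refl))) (+-identityʳ k)
... | inj₂ f≤k with choose-sum (f ∘ suc) (k ∸ f zero)
       (≤-trans (∸-monoˡ-≤ (f zero) k≤) (≤-reflexive (m+n∸m≡n (f zero) _)))
... | g , g≤f , eq = (λ { zero → f zero ; (suc i) → g i })
                   , (λ { zero → ≤-refl ; (suc i) → g≤f i })
                   , ≡.trans (cong (f zero +_) eq) (m+[n∸m]≡n f≤k)

choose : ∀ fs (f : Config fs) k → k ≤ total fs f →
         ∃ λ g → (∀ v → g v ≤ f v) × total fs g ≡ k
choose []       f k k≤ = (λ _ → k) , (λ _ → k≤) , refl
choose (F ∷ fs) f k k≤ with choose-sum _ k k≤
... | ks , ks≤ , eq = (λ (i , v) → proj₁ (slices i) v)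
                    , (λ (i , v) → proj₁ (proj₂ (slices i)) v)
                    , ≡.trans (𝐍.sum-cong-≋ (λ i → proj₂ (proj₂ (slices i)))) eq
  where slices = λ i → choose fs (λ v → f (i , v)) (ks i) (ks≤ i)

-- Arithmetic of pushing pebbles from a leaf to its parent

-- Derives a ≤ b from a linear combination l ≤ r of hypotheses and a semiring identity with slack s.
cancel-≤ : ∀ {a b l r} s → l ≤ r → a + r + s ≡ b + l → a ≤ b
cancel-≤ {a} {b} {l} {r} s l≤r eq = +-cancelʳ-≤ r a b (begin
  a + r      ≤⟨ m≤m+n (a + r) s ⟩
  a + r + s  ≡⟨ eq ⟩
  b + l      ≤⟨ +-monoʳ-≤ b l≤r ⟩
  b + r      ∎)
  where open ≤-Reasoning

-- Bounds the loss when `R` groups of `suc u` pebbles become one pebble each. Adding `u` times the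
-- second hypothesis to the first cancels `u * q` and leaves an inequality with the common factor
-- `suc u`.
push-bound : ∀ u A q R X → A ≤ R * suc u + u * q → A + q ≤ suc u * X → A ≤ R + u * X
push-bound u A q R X h₁ h₂ = *-cancelˡ-≤ (suc u)
  (cancel-≤ 0 (+-mono-≤ h₁ (*-monoʳ-≤ u h₂)) (eq u A q R X))
  where
  eq : ∀ u A q R X → suc u * A + (R * suc u + u * q + u * (suc u * X)) + 0
       ≡ suc u * (R + u * X) + (A + u * (A + q))
  eq = solve-∀

push-one : ∀ u A B R X Z → Z + u * X ≤ A + B → A ≤ R + u * X → Z ≤ B + R
push-one u A B R X Z h₁ h₂ = cancel-≤ 0 (+-mono-≤ h₁ h₂) (eq u A B R X Z)
  where
  eq : ∀ u A B R X Z → Z + (A + B + (R + u * X)) + 0 ≡ B + R + (Z + u * X + A)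
  eq = solve-∀

-- After a push the support `q` counts no longer. The lost pebbles cost at most `u * X` and the lost
-- support at most `M ≤ u * X`, together the amount `2 * (u * X)` by which the threshold drops.
push-two : ∀ u A B q qB R X Z M → 2 * (Z + u * X) < A + B + (q + qB) → A ≤ R + u * X →
           q ≤ M → M ≤ u * X → 2 * Z < B + R + qB
push-two u A B q qB R X Z M h₁ h₂ h₃ h₄ =
  cancel-≤ 0 (+-mono-≤ h₁ (+-mono-≤ h₂ (+-mono-≤ h₃ h₄))) (eq u A B q qB R X Z M)
  where
  eq : ∀ u A B q qB R X Z M →
       suc (2 * Z) + (A + B + (q + qB) + (R + u * X + (M + u * X))) + 0
       ≡ B + R + qB + (suc (2 * (Z + u * X)) + (A + (q + M)))
  eq = solve-∀

-- Here `k` is the number of pebbles missing outside the leaf slice. That part counts for at most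
-- `2 * B`, so the slice counts for more than `2 * k + 2 * (u * X)`; its upper bound then limits
-- `k`.
deficit-bound : ∀ u A B q qB k X → 2 * (B + k + u * X) < A + B + (q + qB) →
                A + q ≤ 2 * (suc u * X) → qB ≤ B → k ≤ X
deficit-bound u A B q qB k X h₁ h₂ h₃ =
  *-cancelˡ-≤ 2 (cancel-≤ 1 (+-mono-≤ h₁ (+-mono-≤ h₂ h₃)) (eq u A B q qB k X))
  where
  eq : ∀ u A B q qB k X →
       2 * k + (A + B + (q + qB) + (2 * (suc u * X) + B)) + 1
       ≡ 2 * X + (suc (2 * (B + k + u * X)) + (A + q + qB))
  eq = solve-∀

-- With `p = w + 2`, the slice counts for more than `2 * k + 2 * (suc w * X)`. This exceeds
-- `p * X + k * p` by `w * (X - k)`, which is where `k ≤ X` enters.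
surplus-bound : ∀ w A B q qB k X → 2 * (B + k + suc w * X) < A + B + (q + qB) →
                qB ≤ B → k ≤ X → suc (suc (suc w) * X + k * suc (suc w)) ≤ A + q
surplus-bound w A B q qB k X h₁ h₂ h₃ =
  cancel-≤ 0 (+-mono-≤ h₁ (+-mono-≤ h₂ (*-monoʳ-≤ w h₃))) (eq w A B q qB k X)
  where
  eq : ∀ w A B q qB k X →
       suc (suc (suc w) * X + k * suc (suc w)) + (A + B + (q + qB) + (B + w * X)) + 0
       ≡ A + q + (suc (2 * (B + k + suc w * X)) + (qB + w * k))
  eq = solve-∀

-- Put `p = suc u`. If `R < k`, the first two hypotheses give `p (X + 1) < (p + 1) q`. Doubling and
-- using `2 q ≤ M + 1 ≤ X + 1` yields `2 p (X + 1) < (p + 1) (X + 1)`, which is false for `p ≥ 1`.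
spare-bound : ∀ u A q k R X M → suc (suc u * X + k * suc u) ≤ A + q →
              A ≤ R * suc u + suc u * q → 2 * q ≤ suc M → M ≤ X → k ≤ R
spare-bound u A q k R X M h₁ h₂ h₃ h₄ = ≮⇒≥ λ h₅ → 1+n≰n {0} (cancel-≤ (suc u + u * M)
  (+-mono-≤ (*-monoʳ-≤ 2 h₁) (+-mono-≤ (*-monoʳ-≤ 2 h₂) (+-mono-≤ (*-monoʳ-≤ (2 * suc u) h₅)
     (+-mono-≤ (*-monoʳ-≤ (suc (suc u)) h₃) (*-monoʳ-≤ (2 * suc u) h₄)))))
  (eq u A q k R X M))
  where
  eq : ∀ u A q k R X M →
       1 + (2 * (A + q) + (2 * (R * suc u + suc u * q) + (2 * suc u * k
            + (suc (suc u) * suc M + 2 * suc u * X)))) + (suc u + u * M)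
       ≡ 0 + (2 * suc (suc u * X + k * suc u) + (2 * A + (2 * suc u * suc R
            + (suc (suc u) * (2 * q) + 2 * suc u * M))))
  eq = solve-∀

-- The remainder is at most `u` and vanishes at an empty vertex, so the loss is charged to the
-- support.
quotient-bound : ∀ u a → a ≤ a / suc u * suc u + u * sg a
quotient-bound u zero      = z≤n
quotient-bound u a@(suc _) = begin
  a                              ≡⟨ m≡m%n+[m/n]*n a (suc u) ⟩
  a % suc u + a / suc u * suc u  ≤⟨ +-monoˡ-≤ _ (≤-pred (m%n<n a (suc u))) ⟩
  u + a / suc u * suc u          ≡⟨ +-comm u _ ⟩
  a / suc u * suc u + u          ≡⟨ cong (a / suc u * suc u +_) (≡.sym (*-identityʳ u)) ⟩
  a / suc u * suc u + u * 1      ∎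
  where open ≤-Reasoning

quotient*≤ : ∀ u a → a / suc u * suc u ≤ a
quotient*≤ u a = ≤-trans (m≤n+m _ (a % suc u)) (≤-reflexive (≡.sym (m≡m%n+[m/n]*n a (suc u))))

-- Holding one pebble back costs at most one more per occupied vertex.
spare-quotient-bound : ∀ u a → a ≤ (a ∸ 1) / suc u * suc u + suc u * sg a
spare-quotient-bound u zero    = z≤n
spare-quotient-bound u (suc a) = begin
  suc a                                ≤⟨ s≤s (quotient-bound u a) ⟩
  suc (a / suc u * suc u + u * sg a)   ≤⟨ s≤s (+-monoʳ-≤ (a / suc u * suc u) (*-monoʳ-≤ u (sg≤1 a))) ⟩
  suc (a / suc u * suc u + u * 1)      ≡⟨ ≡.sym (+-suc _ _) ⟩
  a / suc u * suc u + suc u * 1        ∎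
  where open ≤-Reasoning

sg-∸ : ∀ {a d} → d ≤ a ∸ 1 → sg a ≤ sg (a ∸ d)
sg-∸ {zero}          d≤ = z≤n
sg-∸ {suc a} {d} d≤ = ≤-trans (≤-reflexive (≡.sym (cong sg (+-∸-assoc 1 d≤)))) ≤-refl

-- The number of vertices compared with `Num`

size≥1 : ∀ {k} u (t : Tree k) → 1 ≤ size u t
size≥1 u root    = ≤-refl
size≥1 u (t ▹ y) = ≤-trans (size≥1 u t) (m≤m+n _ _)

Num≥1 : ∀ fs → 1 ≤ Num fs
Num≥1 []       = ≤-refl
Num≥1 (F ∷ fs) = *-mono-≤ (size≥1 (Factor.u F) (Factor.tree F)) (Num≥1 fs)

Small : List Factor → Set
Small fs = 2 * ∣V∣ fs ≤ suc (Num fs)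

-- A new vertex adds `u * p ^ d`, at least 2 because `u = w + 2`. For the prime 2 the bound already
-- fails on a single edge.
2k≤suc-size : ∀ {k} w (t : Tree k) → 2 * k ≤ suc (size (suc (suc w)) t)
2k≤suc-size w root            = ≤-refl
2k≤suc-size {suc k} w (t ▹ y) = begin
  2 * suc k               ≡⟨ *-suc 2 k ⟩
  2 + 2 * k               ≡⟨ +-comm 2 (2 * k) ⟩
  2 * k + 2               ≤⟨ +-mono-≤ (2k≤suc-size w t)
                               (*-mono-≤ (s≤s (s≤s (z≤n {w}))) (m^n>0 (suc (suc (suc w))) (depth t y))) ⟩
  suc (size (suc (suc w)) t) + suc (suc w) * suc (suc (suc w)) ^ depth t y ∎
  where open ≤-Reasoning

∣V∣-∷ : ∀ F fs → ∣V∣ (F ∷ fs) ≡ Factor.k F * ∣V∣ fs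
∣V∣-∷ F fs = sum-const (Factor.k F) (∣V∣ fs)
  where
  sum-const : ∀ n x → 𝐍.sum {n} (λ _ → x) ≡ n * x
  sum-const zero    x = refl
  sum-const (suc n) x = cong (x +_) (sum-const n x)

-- The condition is multiplicative because `(m + 1) (n + 1) ≤ 2 (m n + 1)`: the difference is
-- `(m - 1) (n - 1)`.
half-* : ∀ {a b m n} → 2 * a ≤ suc m → 2 * b ≤ suc n → 1 ≤ m → 1 ≤ n → 2 * (a * b) ≤ suc (m * n)
half-* {a} {b} {suc m} {suc n} ha hb (s≤s _) (s≤s _) = *-cancelˡ-≤ 2 (begin
  2 * (2 * (a * b))                  ≡⟨ eq₁ a b ⟩
  2 * a * (2 * b)                    ≤⟨ *-mono-≤ ha hb ⟩
  suc (suc m) * suc (suc n)          ≤⟨ m≤m+n _ (m * n) ⟩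
  suc (suc m) * suc (suc n) + m * n  ≡⟨ eq₂ m n ⟩
  2 * suc (suc m * suc n)            ∎)
  where
  open ≤-Reasoning
  eq₁ : ∀ a b → 2 * (2 * (a * b)) ≡ 2 * a * (2 * b)
  eq₁ = solve-∀
  eq₂ : ∀ a b → suc (suc a) * suc (suc b) + a * b ≡ 2 * suc (suc a * suc b)
  eq₂ = solve-∀

small-∷ : ∀ {k} w (t : Tree k) fs → Small fs → Small (factor (suc (suc w)) t ∷ fs)
small-∷ {k} w t fs h = subst (λ v → 2 * v ≤ suc (Num (factor (suc (suc w)) t ∷ fs)))
  (≡.sym (∣V∣-∷ (factor (suc (suc w)) t) fs))
  (half-* {k} {∣V∣ fs} (2k≤suc-size w t) h (size≥1 (suc (suc w)) t) (Num≥1 fs))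

support≤Num : ∀ {fs} → Small fs → ∀ c → support fs c ≤ Num fs
support≤Num {fs} small c = *-cancelˡ-≤ 2 (begin
  2 * support fs c   ≤⟨ *-monoʳ-≤ 2 (support≤∣V∣ fs c) ⟩
  2 * ∣V∣ fs         ≤⟨ small ⟩
  1 + Num fs         ≤⟨ +-monoˡ-≤ (Num fs) (Num≥1 fs) ⟩
  Num fs + Num fs    ≡⟨ cong (Num fs +_) (≡.sym (+-identityʳ (Num fs))) ⟩
  2 * Num fs         ∎)
  where open ≤-Reasoning

-- Edge relations on products of trees

TreeEdges : ∀ {x r} {X : Set x} → (ℕ → X → X → Set r) → ∀ {k} → ℕ → Tree k → (Fin k → X) → Set r
TreeEdges {r = r} R u root    f = Lift r ⊤
TreeEdges         R u (t ▹ y) f = R u (f zero) (f (suc y)) × TreeEdges R u t (f ∘ suc)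

-- The edges of the Cartesian product: one coordinate follows its tree and the others stay fixed.
-- The relation is a parameter so that `map-edges` can turn moves between subgroups into pebbling
-- steps.
Edges : ∀ {x r} {X : Set x} → (ℕ → X → X → Set r) → ∀ fs → (Vertex fs → X) → Set r
Edges {r = r} R []       f = Lift r ⊤
Edges         R (F ∷ fs) f = (∀ i → Edges R fs (λ v → f (i , v)))
                           × (∀ v → TreeEdges R (Factor.u F) (Factor.tree F) (λ i → f (i , v)))

module _ {x y r s} {X : Set x} {Y : Set y} {R : ℕ → X → X → Set r} {S : ℕ → Y → Y → Set s}
         {h : X → Y} (RS : ∀ {u a b} → R u a b → S u (h a) (h b)) where
  map-treeEdges : ∀ {k} u (t : Tree k) {f} → TreeEdges R u t f → TreeEdges S u t (h ∘ f)
  map-treeEdges u root    _       = lift tt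
  map-treeEdges u (t ▹ y) (e , es) = RS e , map-treeEdges u t es

  map-edges : ∀ fs {f} → Edges R fs f → Edges S fs (h ∘ f)
  map-edges []       _         = lift tt
  map-edges (F ∷ fs) (es , ts) = (λ i → map-edges fs (es i))
                               , (λ v → map-treeEdges (Factor.u F) (Factor.tree F) (ts v))

-- Pebbling on products of trees

module Pebbling {a b o} (𝓐 : AffineMonoid a b o) where
  open AffineMonoid 𝓐

  Edge : ℕ → Carrier → Carrier → Set o
  Edge u x y = (suc u · x) ⊢ y

  ClosedTree : ∀ {k} → ℕ → Tree k → (Fin k → Carrier) → Set o
  ClosedTree = TreeEdges Edge

  Closed : ∀ fs → (Vertex fs → Carrier) → Set o
  Closed = Edges Edge

  val : ∀ fs → (Vertex fs → Carrier) → Config fs → Carrier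
  val fs P c = ∑ fs (λ v → c v · P v)

  -- `One` says that `Num fs` bounds the pebbling number of the root; `Two` is the two-pebbling
  -- property with that bound. Both quantify over `P`, since the induction restricts `P` to slices
  -- and to smaller trees.
  One Two : List Factor → Set (a ⊔ o)
  One fs = ∀ P → Closed fs P → ∀ c → Num fs ≤ total fs c → val fs P c ⊢ P (origin fs)
  Two fs = ∀ P → Closed fs P → ∀ c → 2 * Num fs < total fs c + support fs c →
           val fs P c ⊢ (2 · P (origin fs))

  Many : List Factor → Set (a ⊔ o)
  Many fs = ∀ P → Closed fs P → ∀ t c → (2 + t) * Num fs < total fs c + support fs c →
            val fs P c ⊢ ((2 + t) · P (origin fs))

  val-+ : ∀ fs P {c d e} → (∀ v → c v ≡ d v + e v) → val fs P c ⊢ (val fs P d ⊕ val fs P e)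
  val-+ fs P {c} {d} {e} h = reflexive (≈-trans
    (∑-cong fs (λ v → ≈-trans (×-congˡ (h v)) (×-homo-+ (P v) (d v) (e v))))
    (∑-⊕ fs (λ v → d v · P v) (λ v → e v · P v)))

  val-∸ : ∀ fs P {c d} → (∀ v → d v ≤ c v) → val fs P c ⊢ (val fs P d ⊕ val fs P (λ v → c v ∸ d v))
  val-∸ fs P {c} {d} h = val-+ fs P {d = d} (λ v → ≡.sym (m+[n∸m]≡n (h v)))

  val-drop : ∀ fs P {c d} → (∀ v → d v ≤ c v) → val fs P c ⊢ val fs P d
  val-drop fs P {c} {d} h = ∑-mono fs (λ v → ·-mono-≤ (P v) (h v))

  val-push : ∀ fs {P P′} u r → (∀ v → (suc u · P v) ⊢ P′ v) →
             val fs P (λ v → r v * suc u) ⊢ val fs P′ r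
  val-push fs {P} u r h = ∑-mono fs (λ v →
    reflexive (≈-sym (×-assocˡ (P v) (r v) (suc u))) ⟫ ·-mono (r v) (h v))

  climb : ∀ {k} u (t : Tree k) {P} → ClosedTree u t P →
          ∀ x → ((suc u ^ depth t x) · P x) ⊢ P (rootOf t)
  climb u root        cl zero = reflexive (×-homo-1 _)
  climb u (t ▹ y) {P} (e , cl) zero    =
    reflexive (≈-trans (×-congˡ (*-comm (suc u) (suc u ^ depth t y)))
                       (≈-sym (×-assocˡ (P zero) (suc u ^ depth t y) (suc u))))
    ⟫ ·-mono (suc u ^ depth t y) e ⟫ climb u t cl y
  climb u (t ▹ y) (e , cl) (suc x) = climb u t cl x

  -- While A ≥ 2M, the M pebbles to be spent can be taken without emptying any vertex.
  many : ∀ fs → Small fs → One fs → Two fs → Many fs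
  many fs small one two P cl zero    c h = two P cl c h
  many fs small one two P cl (suc t) c h =
    val-∸ fs P d≤c ⟫ ⊕-mono (one P cl d (≤-reflexive (≡.sym total-d)))
                            (many fs small one two P cl t (λ v → c v ∸ d v) h′)
    where
    M = Num fs
    q = support fs c
    q≤M : q ≤ M
    q≤M = support≤Num small c
    eq₁ : ∀ M q A t → M + q + (A + q + (M + M)) + suc (t * M) ≡ A + (suc ((3 + t) * M) + (q + q))
    eq₁ = solve-∀
    M+q≤A : M + q ≤ total fs c
    M+q≤A = cancel-≤ (suc (t * M)) (+-mono-≤ h (+-mono-≤ q≤M q≤M)) (eq₁ M q (total fs c) t)
    sg+∸1 : ∀ n → sg n + (n ∸ 1) ≡ n
    sg+∸1 zero    = refl
    sg+∸1 (suc n) = refl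
    total-split : q + total fs (λ v → c v ∸ 1) ≡ total fs c
    total-split = ≡.trans (≡.sym (𝐍.∑-⊕ fs (sg ∘ c) (λ v → c v ∸ 1))) (𝐍.∑-cong fs (sg+∸1 ∘ c))
    chosen = choose fs (λ v → c v ∸ 1) M
      (+-cancelˡ-≤ q _ _ (≤-trans (≤-reflexive (+-comm q M)) (≤-trans M+q≤A (≤-reflexive (≡.sym total-split)))))
    d = proj₁ chosen
    d≤c∸1 = proj₁ (proj₂ chosen)
    total-d = proj₂ (proj₂ chosen)
    d≤c : ∀ v → d v ≤ c v
    d≤c v = ≤-trans (d≤c∸1 v) (m∸n≤m (c v) 1)
    A′ = total fs (λ v → c v ∸ d v)
    A≡ : total fs c ≡ M + A′
    A≡ = ≡.trans (𝐍.∑-cong fs (λ v → ≡.sym (m+[n∸m]≡n (d≤c v))))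
        (≡.trans (𝐍.∑-⊕ fs d (λ v → c v ∸ d v)) (cong (_+ A′) total-d))
    q≤q′ : q ≤ support fs (λ v → c v ∸ d v)
    q≤q′ = 𝐍.∑-mono fs (λ v → sg-∸ (d≤c∸1 v))
    h′ : (2 + t) * M < A′ + support fs (λ v → c v ∸ d v)
    h′ = ≤-trans (+-cancelˡ-≤ M _ _ (≤-trans (≤-reflexive (+-suc M _))
           (≤-trans h (≤-reflexive (≡.trans (cong (_+ q) A≡) (+-assoc M A′ q))))))
         (+-monoʳ-≤ A′ q≤q′)

  module Step (fs : List Factor) (w : ℕ) (small : Small fs) (one : One fs) (two : Two fs) where
    u = suc w
    M = Num fs

    𝓕 : ∀ {k} → Tree k → List Factor
    𝓕 t = factor u t ∷ fs

    many′ : ∀ t P → Closed fs P → ∀ c → 2 ≤ t → t * M < total fs c + support fs c →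
            val fs P c ⊢ (t · P (origin fs))
    many′ (suc (suc t)) P cl c _ h = many fs small one two P cl t c h
    many′ (suc zero) P cl c (s≤s ()) h

    add : ∀ {k} (t : Tree k) → Fin k → Config fs → Config (𝓕 t) → Config (𝓕 t)
    add t y r c (i , v) = c (i , v) + δ y i * r v

    total-δ : ∀ {k} (t : Tree k) y r → total (𝓕 t) (λ (i , v) → δ y i * r v) ≡ total fs r
    total-δ {k} t y r = ≡.trans
      (𝐍.sum-cong-≋ {k} (λ i → ≡.trans (total-* fs (δ y i) r) (≡.sym (·≡* (δ y i) _))))
      (𝐍.sum-δ y (λ _ → total fs r))

    total-add : ∀ {k} (t : Tree k) y r c → total (𝓕 t) (add t y r c) ≡ total (𝓕 t) c + total fs r
    total-add t y r c = ≡.trans (𝐍.∑-⊕ (𝓕 t) c (λ (i , v) → δ y i * r v))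
                                (cong (total (𝓕 t) c +_) (total-δ t y r))

    support-add : ∀ {k} (t : Tree k) y r c → support (𝓕 t) c ≤ support (𝓕 t) (add t y r c)
    support-add t y r c = 𝐍.∑-mono (𝓕 t) (λ v → sg-mono (m≤m+n (c v) _))

    val-add : ∀ {k} (t : Tree k) y r c P →
              (val fs (λ v → P (y , v)) r ⊕ val (𝓕 t) P c) ⊢ val (𝓕 t) P (add t y r c)
    val-add {k} t y r c P = reflexive (≈-trans (⊕-comm _ _) (≈-sym (≈-trans
      (∑-cong (𝓕 t) (λ (i , v) → ×-homo-+ (P (i , v)) (c (i , v)) (δ y i * r v)))
      (≈-trans (∑-⊕ (𝓕 t) (λ v → c v · P v) (λ (i , v) → (δ y i * r v) · P (i , v)))
      (⊕-cong ≈-refl (≈-trans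
        (sum-cong-≋ {k} (λ i → ≈-trans
          (∑-cong fs (λ v → ≈-sym (×-assocˡ (P (i , v)) (δ y i) (r v))))
          (∑-· fs (δ y i) (λ v → r v · P (i , v)))))
        (sum-δ y (λ i → val fs (λ v → P (i , v)) r))))))))

    total-*ʳ : ∀ c n → total fs (λ v → c v * n) ≡ total fs c * n
    total-*ʳ c n = ≡.trans (𝐍.∑-cong fs (λ v → *-comm (c v) n))
                  (≡.trans (total-* fs n c) (*-comm n (total fs c)))

    total-bound : ∀ {c} r s n → (∀ v → c v ≤ r v * suc u + n * s v) →
                  total fs c ≤ total fs r * suc u + n * total fs s
    total-bound r s n h = ≤-trans (𝐍.∑-mono fs h)
      (≤-reflexive (≡.trans (𝐍.∑-⊕ fs (λ v → r v * suc u) (λ v → n * s v))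
        (cong₂ _+_ (total-*ʳ r (suc u)) (total-* fs n s))))

    -- `a₀`, `A` and `q` describe the slice over the new leaf, and `c₁`, `B` and `qB` the rest. `Z`
    -- is the number required without the leaf, which raises it by `u * X`; `suc u * X` is the
    -- threshold at which the slice alone yields a pebble.
    module Leaf {k} (t : Tree k) (y : Fin k) (P : Vertex (𝓕 (t ▹ y)) → Carrier)
                (cl : Closed (𝓕 (t ▹ y)) P) (c : Config (𝓕 (t ▹ y))) where
      P₀ : Vertex fs → Carrier
      P₀ v = P (zero , v)
      P₁ : Vertex (𝓕 t) → Carrier
      P₁ (i , v) = P (suc i , v)
      cl₁ : Closed (𝓕 t) P₁
      cl₁ = (λ i → proj₁ cl (suc i)) , (λ v → proj₂ (proj₂ cl v))
      edge : ∀ v → (suc u · P₀ v) ⊢ P₁ (y , v)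
      edge v = proj₁ (proj₂ cl v)
      a₀ : Config fs
      a₀ v = c (zero , v)
      c₁ : Config (𝓕 t)
      c₁ (i , v) = c (suc i , v)
      A = total fs a₀
      q = support fs a₀
      B = total (𝓕 t) c₁
      qB = support (𝓕 t) c₁
      N = size u t
      D = suc u ^ depth t y
      X = D * M
      Z = N * M

      M≤X : M ≤ X
      M≤X = ≤-trans (≤-reflexive (≡.sym (*-identityˡ M))) (*-monoˡ-≤ M (m^n>0 (suc u) (depth t y)))

      Num≡ : Num (𝓕 (t ▹ y)) ≡ Z + u * X
      Num≡ = eq N u D M
        where
        eq : ∀ N u D M → (N + u * D) * M ≡ N * M + u * (D * M)
        eq = solve-∀

      -- `many′` gathers `s * (suc u * D)` pebbles at the point of the slice over `origin fs`, and
      -- `climb` spends `suc u * D` of them for each pebble that reaches the root.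
      from-leaf : ∀ s a → 1 ≤ s → s * (suc u * X) < total fs a + support fs a →
                  val fs P₀ a ⊢ (s · P (origin (𝓕 (t ▹ y))))
      from-leaf s a 1≤s h =
        many′ (s * (suc u * D)) P₀ (proj₁ cl zero) a
              -- `many′` asks for a target of at least 2; the prime `suc u` provides this factor
              -- because `u = suc w`.
              (*-mono-≤ 1≤s (*-mono-≤ (s≤s (s≤s (z≤n {w}))) (m^n>0 (suc u) (depth t y))))
              (≤-trans (s≤s (≤-reflexive (eq s (suc u) D M))) h)
        ⟫ reflexive (≈-sym (×-assocˡ _ s (suc u * D)))
        ⟫ ·-mono s (climb u (t ▹ y) {λ i → P (i , origin fs)} (proj₂ cl (origin fs)) zero)
        where
        eq : ∀ s p D M → s * (p * D) * M ≡ s * (p * (D * M))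
        eq = solve-∀

      r : Config fs
      r v = a₀ v / suc u
      R = total fs r

      pushed : Config (𝓕 t)
      pushed = add t y r c₁

      push : val (𝓕 (t ▹ y)) P c ⊢ val (𝓕 t) P₁ pushed
      push = ⊕-mono (val-drop fs P₀ {a₀} {λ v → r v * suc u} (λ v → quotient*≤ u (a₀ v))
                     ⟫ val-push fs u r edge) ⊢-refl
             ⟫ val-add t y r c₁ P₁

      A≤ : A ≤ R * suc u + u * q
      A≤ = total-bound r (sg ∘ a₀) u (λ v → quotient-bound u (a₀ v))

      leaf-one : One (𝓕 t) → Num (𝓕 (t ▹ y)) ≤ total (𝓕 (t ▹ y)) c →
                 val (𝓕 (t ▹ y)) P c ⊢ P (origin (𝓕 (t ▹ y)))
      leaf-one IH h with <-≤-connex (suc u * X) (A + q)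
      ... | inj₁ many-above = dropʳ
        ⟫ from-leaf 1 a₀ ≤-refl (≤-trans (≤-reflexive (cong suc (*-identityˡ _))) many-above)
        ⟫ reflexive (×-homo-1 _)
      ... | inj₂ few-above = push ⟫ IH P₁ cl₁ pushed
        (≤-trans (push-one u A B R X Z (≤-trans (≤-reflexive (≡.sym Num≡)) h)
                    (push-bound u A q R X A≤ few-above))
                 (≤-reflexive (≡.sym (total-add t y r c₁))))

      -- The rest yields one pebble once `Z ≤ B`; the slice yields one or two according to the
      -- threshold it passes. If `B < Z`, either the slice yields both or `deficient` applies. If
      -- `Z ≤ B`, either each part yields one or everything is pushed and `IH₂` yields two.
      leaf-two : One (𝓕 t) → Two (𝓕 t) →
                 2 * Num (𝓕 (t ▹ y)) < total (𝓕 (t ▹ y)) c + support (𝓕 (t ▹ y)) c →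
                 val (𝓕 (t ▹ y)) P c ⊢ (2 · P (origin (𝓕 (t ▹ y))))
      leaf-two IH₁ IH₂ h = cases (<-≤-connex B Z)
        (<-≤-connex (suc u * X) (A + q)) (<-≤-connex (2 * (suc u * X)) (A + q))
        where
        h′ : 2 * (Z + u * X) < A + B + (q + qB)
        h′ = ≤-trans (s≤s (≤-reflexive (cong (2 *_) (≡.sym Num≡)))) h

        -- Push exactly the Z ∸ B pebbles missing below y, keeping every vertex over the leaf occupied:
        -- then one pebble comes from below the leaf and another one from the rest of the leaf slice.
        deficient : B < Z → A + q ≤ 2 * (suc u * X) →
                    val (𝓕 (t ▹ y)) P c ⊢ (2 · P (origin (𝓕 (t ▹ y))))
        deficient B<Z few = ⊕-mono (val-∸ fs P₀ {a₀} {λ v → s v * suc u} s*≤a) ⊢-refl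
          ⟫ reflexive (≈-trans (⊕-cong (⊕-comm _ _) ≈-refl) (⊕-assoc _ _ _))
          ⟫ ⊕-mono (from-leaf 1 a′ ≤-refl (≤-trans (≤-reflexive (cong suc (*-identityˡ _))) above)
                     ⟫ reflexive (×-homo-1 _))
                   (⊕-mono (val-push fs u s edge) ⊢-refl ⟫ val-add t y s c₁ P₁
                     ⟫ IH₁ P₁ cl₁ (add t y s c₁) below ⟫ reflexive (≈-sym (×-homo-1 _)))
          where
          k′ = Z ∸ B
          B+k≡Z : B + k′ ≡ Z
          B+k≡Z = m+[n∸m]≡n (<⇒≤ B<Z)
          h″ : 2 * (B + k′ + u * X) < A + B + (q + qB)
          h″ = subst (λ z → 2 * (z + u * X) < A + B + (q + qB)) (≡.sym B+k≡Z) h′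
          qB≤B : qB ≤ B
          qB≤B = support≤total (𝓕 t) c₁
          surplus : suc (suc u * X + k′ * suc u) ≤ A + q
          surplus = surplus-bound w A B q qB k′ X h″ qB≤B (deficit-bound u A B q qB k′ X h″ few qB≤B)
          spare : Config fs
          spare v = (a₀ v ∸ 1) / suc u
          A≤spare : A ≤ total fs spare * suc u + suc u * q
          A≤spare = total-bound spare (sg ∘ a₀) (suc u) (λ v → spare-quotient-bound u (a₀ v))
          chosen = choose fs spare k′ (spare-bound u A q k′ (total fs spare) X M surplus A≤spare
            (≤-trans (*-monoʳ-≤ 2 (support≤∣V∣ fs a₀)) small) M≤X)
          s = proj₁ chosen
          s*≤a∸1 : ∀ v → s v * suc u ≤ a₀ v ∸ 1
          s*≤a∸1 v = ≤-trans (*-monoˡ-≤ (suc u) (proj₁ (proj₂ chosen) v)) (quotient*≤ u (a₀ v ∸ 1))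
          s*≤a : ∀ v → s v * suc u ≤ a₀ v
          s*≤a v = ≤-trans (s*≤a∸1 v) (m∸n≤m (a₀ v) 1)
          a′ : Config fs
          a′ v = a₀ v ∸ s v * suc u
          A≡ : A ≡ total fs a′ + k′ * suc u
          A≡ = ≡.trans (𝐍.∑-cong fs (λ v → ≡.sym (m∸n+n≡m (s*≤a v))))
              (≡.trans (𝐍.∑-⊕ fs a′ (λ v → s v * suc u))
              (cong (total fs a′ +_) (≡.trans (total-*ʳ s (suc u)) (cong (_* suc u) (proj₂ (proj₂ chosen))))))
          above : suc u * X < total fs a′ + support fs a′
          above = cancel-≤ 0 (+-mono-≤ surplus (+-mono-≤ (≤-reflexive A≡) (𝐍.∑-mono fs (λ v → sg-∸ (s*≤a∸1 v)))))
                    (eq (suc u * X) (k′ * suc u) A q (total fs a′) (support fs a′))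
            where
            eq : ∀ x k A q A′ q′ → suc x + (A + q + (A′ + k + q′)) + 0 ≡ A′ + q′ + (suc (x + k) + (A + q))
            eq = solve-∀
          below : Z ≤ total (𝓕 t) (add t y s c₁)
          below = ≤-reflexive (≡.trans (≡.sym B+k≡Z)
            (≡.trans (cong (B +_) (≡.sym (proj₂ (proj₂ chosen)))) (≡.sym (total-add t y s c₁))))

        cases : (B < Z ⊎ Z ≤ B) → (suc u * X < A + q ⊎ A + q ≤ suc u * X) →
                (2 * (suc u * X) < A + q ⊎ A + q ≤ 2 * (suc u * X)) →
                val (𝓕 (t ▹ y)) P c ⊢ (2 · P (origin (𝓕 (t ▹ y))))
        cases (inj₁ B<Z) _ (inj₁ h₂) = dropʳ ⟫ from-leaf 2 a₀ (s≤s z≤n) h₂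
        cases (inj₁ B<Z) _ (inj₂ h₂) = deficient B<Z h₂
        cases (inj₂ Z≤B) (inj₁ h₁) _ = ⊕-mono
          (from-leaf 1 a₀ ≤-refl (≤-trans (≤-reflexive (cong suc (*-identityˡ _))) h₁) ⟫ reflexive (×-homo-1 _))
          (IH₁ P₁ cl₁ c₁ Z≤B ⟫ reflexive (≈-sym (×-homo-1 _)))
        cases (inj₂ Z≤B) (inj₂ h₁) _ = push ⟫ IH₂ P₁ cl₁ pushed
          (≤-trans (push-two u A B q qB R X Z M h′ (push-bound u A q R X A≤ h₁)
                     (support≤Num small a₀)
                     (≤-trans M≤X (m≤m+n X (w * X))))
            (+-mono-≤ (≤-reflexive (≡.sym (total-add t y r c₁))) (support-add t y r c₁)))

    one-step : ∀ {k} (t : Tree k) → One (𝓕 t)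
    one-step root P cl c h =
      reflexive (⊕-identityʳ _) ⟫ one (λ v → P (zero , v)) (proj₁ cl zero) (λ v → c (zero , v))
        (≤-trans (≤-reflexive (≡.sym (*-identityˡ M))) (≤-trans h (≤-reflexive (+-identityʳ _))))
    one-step (t ▹ y) P cl c h = Leaf.leaf-one t y P cl c (one-step t) h

    two-step : ∀ {k} (t : Tree k) → Two (𝓕 t)
    two-step root P cl c h =
      reflexive (⊕-identityʳ _) ⟫ two (λ v → P (zero , v)) (proj₁ cl zero) (λ v → c (zero , v))
        (≤-trans (s≤s (≤-reflexive (cong (2 *_) (≡.sym (*-identityˡ M)))))
          (≤-trans h (≤-reflexive (cong₂ _+_
            (+-identityʳ (total fs (λ v → c (zero , v)))) (+-identityʳ (support fs (λ v → c (zero , v))))))))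
    two-step (t ▹ y) P cl c h = Leaf.leaf-two t y P cl c (one-step t) (two-step t) h

  one-[] : One []
  one-[] P cl c h = ·-mono-≤ (P tt) h ⟫ reflexive (×-homo-1 _)

  two-[] : Two []
  two-[] P cl c h = ·-mono-≤ (P tt) (2≤ (c tt) h)
    where
    2≤ : ∀ n → 2 < n + sg n → 2 ≤ n
    2≤ (suc zero)    (s≤s (s≤s ()))
    2≤ (suc (suc n)) h = s≤s (s≤s z≤n)

-- Zero-sum subsets modulo `p`

subsetSumℕ : ∀ {k} → (Fin k → Bool) → (Fin k → ℕ) → ℕ
subsetSumℕ {zero}  J f = 0
subsetSumℕ {suc k} J f = (if J zero then f zero else 0) + subsetSumℕ (J ∘ suc) (f ∘ suc)

prefix : ∀ {k} → (Fin k → ℕ) → Fin (suc k) → ℕ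
prefix f zero                = 0
prefix {suc k} f (suc i)     = f zero + prefix (f ∘ suc) i

-- The half-open interval `i ≤ l < j`, empty if `j ≤ i`; its end points range over `Fin (suc k)`,
-- like the `k + 1` prefix sums.
interval : ∀ {k} → Fin (suc k) → Fin (suc k) → Fin k → Bool
interval {suc k} zero    zero    l       = false
interval {suc k} zero    (suc j) zero    = true
interval {suc k} zero    (suc j) (suc l) = interval zero j l
interval {suc k} (suc i) zero    l       = false
interval {suc k} (suc i) (suc j) zero    = false
interval {suc k} (suc i) (suc j) (suc l) = interval i j l

subsetSumℕ-none : ∀ {k} (f : Fin k → ℕ) → subsetSumℕ (λ _ → false) f ≡ 0
subsetSumℕ-none {zero}  f = refl
subsetSumℕ-none {suc k} f = subsetSumℕ-none (f ∘ suc)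

prefix-interval : ∀ {k} (f : Fin k → ℕ) i j → i Fin.≤ j →
                  prefix f j ≡ prefix f i + subsetSumℕ (interval i j) f
prefix-interval {zero}  f zero    zero    h = refl
prefix-interval {suc k} f zero    zero    h = ≡.sym (subsetSumℕ-none f)
prefix-interval {suc k} f zero    (suc j) h = cong (f zero +_) (prefix-interval (f ∘ suc) zero j z≤n)
prefix-interval {suc k} f (suc i) (suc j) (s≤s h) =
  ≡.trans (cong (f zero +_) (prefix-interval (f ∘ suc) i j h)) (≡.sym (+-assoc (f zero) _ _))

interval-nonempty : ∀ {k} (i j : Fin (suc k)) → i Fin.< j → ∃ λ l → interval i j l ≡ true
interval-nonempty {suc k} zero    (suc j) h       = zero , refl
interval-nonempty {suc k} (suc i) (suc j) (s≤s h) with interval-nonempty i j h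
... | l , eq = suc l , eq

%≡⇒∣∸ : ∀ a b p .{{_ : NonZero p}} → a % p ≡ (a + b) % p → p ∣ b
%≡⇒∣∸ a b p eq = ∣m+n∣m⇒∣n (subst (p ∣_) key (n∣m*n ((a + b) / p))) (n∣m*n (a / p))
  where
  open ≡.≡-Reasoning
  key : (a + b) / p * p ≡ a / p * p + b
  key = +-cancelˡ-≡ (a % p) _ _ (begin
    a % p + (a + b) / p * p        ≡⟨ cong (_+ (a + b) / p * p) eq ⟩
    (a + b) % p + (a + b) / p * p  ≡⟨ m≡m%n+[m/n]*n (a + b) p ⟨
    a + b                          ≡⟨ cong (_+ b) (m≡m%n+[m/n]*n a p) ⟩
    a % p + a / p * p + b          ≡⟨ +-assoc (a % p) _ b ⟩
    a % p + (a / p * p + b)        ∎)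

-- Two of the p + 1 prefix sums agree modulo p.
zero-sum-mod : ∀ p .{{_ : NonZero p}} (f : Fin p → ℕ) →
               ∃ λ J → (∃ λ i → J i ≡ true) × p ∣ subsetSumℕ J f
zero-sum-mod p f with pigeonhole (n<1+n p) (λ i → prefix f i mod p)
... | i , j , i<j , eq = interval i j , interval-nonempty i j i<j , %≡⇒∣∸ (prefix f i) _ p (begin
  prefix f i % p                                ≡⟨ toℕ-fromℕ< (m%n<n (prefix f i) p) ⟨
  toℕ (prefix f i mod p)                        ≡⟨ cong toℕ eq ⟩
  toℕ (prefix f j mod p)                        ≡⟨ toℕ-fromℕ< (m%n<n (prefix f j) p) ⟩
  prefix f j % p                                ≡⟨ cong (_% p) (prefix-interval f i j (<⇒≤ i<j)) ⟩
  (prefix f i + subsetSumℕ (interval i j) f) % p    ∎)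
  where open ≡.≡-Reasoning

-- Coprimality and prime powers

coprime-*ʳ : ∀ {a b c} → Coprime a b → Coprime a c → Coprime a (b * c)
coprime-*ʳ {a} {b} {c} ab ac {d} (d∣a , d∣bc) =
  ac (d∣a , coprime-divisor (λ (e∣d , e∣b) → ab (∣-trans e∣d d∣a , e∣b)) d∣bc)

coprime-^ʳ : ∀ {a b} n → Coprime a b → Coprime a (b ^ n)
coprime-^ʳ {a} zero    h (_ , d∣1) = ∣1⇒≡1 d∣1
coprime-^ʳ     (suc n) h = coprime-*ʳ h (coprime-^ʳ n h)

coprime-∣ : ∀ {a b a′ b′} → Coprime a b → a′ ∣ a → b′ ∣ b → Coprime a′ b′
coprime-∣ h a′∣a b′∣b (d∣a′ , d∣b′) = h (∣-trans d∣a′ a′∣a , ∣-trans d∣b′ b′∣b)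

coprime-*-∣ : ∀ {a b k} → Coprime a b → a ∣ k → b ∣ k → a * b ∣ k
coprime-*-∣ {a} {b} h (divides x refl) b∣k = subst (_∣ x * a) (*-comm b a)
  (*-monoˡ-∣ a (coprime-divisor (Coprimality.sym h) (subst (b ∣_) (*-comm x a) b∣k)))

prime∤⇒coprime : ∀ {p k} → Prime p → ¬ p ∣ k → Coprime k p
prime∤⇒coprime {p} pr p∤k {d} (d∣k , d∣p) with prime⇒irreducible pr d∣p
... | inj₁ d≡1 = d≡1
... | inj₂ refl = contradiction d∣k p∤k

-- Induction on the exponent: if `p` does not divide `o`, then `o` is coprime to `p` and divides the
-- smaller power; otherwise a factor `p` cancels.
∣-prime-power : ∀ {p} → Prime p → ∀ a {o} → o ∣ p ^ a → ∃ λ d → o ≡ p ^ d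
∣-prime-power pr zero o∣1 = 0 , ∣1⇒≡1 o∣1
∣-prime-power {p} pr (suc a) {o} o∣ with p ∣? o
... | no p∤o = ∣-prime-power pr a (coprime-divisor (prime∤⇒coprime pr p∤o) o∣)
... | yes (divides o′ refl) with ∣-prime-power pr a {o′}
        (*-cancelˡ-∣ p {{prime⇒nonZero pr}} (subst (_∣ p * p ^ a) (*-comm o′ p) o∣))
...   | d , refl = suc d , *-comm (p ^ d) p

-- One index for each generator of each cyclic subgroup in the tree: a pair stands for an exponent
-- below the order of the subgroup and prime to `suc u`.
TreeIndex : ∀ {k} → ℕ → Tree k → Set
TreeIndex u root    = ⊤
TreeIndex u (t ▹ y) = TreeIndex u t ⊎ (Fin (suc u ^ depth t y) × Fin u)

Index : List Factor → Set
Index []       = ⊤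
Index (F ∷ fs) = TreeIndex (Factor.u F) (Factor.tree F) × Index fs

-- Torsion and subset sums in an abelian group

module GroupLemmas {c ℓ} (G : AbelianGroup c ℓ) where
  open AbelianGroup G renaming (refl to ≈-refl; sym to ≈-sym; trans to ≈-trans; reflexive to ≈-reflexive)
  open CMMult commutativeMonoid
    using (×-congʳ; ×-congˡ; ×-homo-1; ×-homo-+; ×-assocˡ; ×-distrib-+)
    renaming (_×_ to _·_) public
  open AbelianGroupProperties G using (∙-cancelˡ; identityʳ-unique)
  open CommutativeSemigroupProperties commutativeSemigroup using (interchange)
  open SetoidReasoning setoid

  •≡· : ∀ k x → _•_ G k x ≡ k · x
  •≡· zero    x = refl
  •≡· (suc k) x = cong (x ∙_) (•≡· k x)

  ·-ε : ∀ k → k · ε ≈ ε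
  ·-ε zero    = ≈-refl
  ·-ε (suc k) = ≈-trans (identityˡ _) (·-ε k)

  ·-swap : ∀ m n x → m · (n · x) ≈ n · (m · x)
  ·-swap m n x = begin
    m · (n · x)   ≈⟨ ×-assocˡ x m n ⟩
    (m * n) · x   ≡⟨ cong (_· x) (*-comm m n) ⟩
    (n * m) · x   ≈⟨ ×-assocˡ x n m ⟨
    n · (m · x)   ∎

  kill-· : ∀ {m x} k → m · x ≈ ε → m · (k · x) ≈ ε
  kill-· {m} {x} k h = ≈-trans (·-swap m k x) (≈-trans (×-congʳ k h) (·-ε k))

  kill-∣ : ∀ {m k x} → m · x ≈ ε → m ∣ k → k · x ≈ ε
  kill-∣ {m} {x = x} h (divides q refl) =
    ≈-trans (≈-sym (×-assocˡ x q m)) (≈-trans (×-congʳ q h) (·-ε q))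

  -- By Bézout some multiple of `b` is 1 modulo `a`. It fixes the `a`-torsion and kills the
  -- `b`-torsion, so it acts as the projection in the two results that follow.
  coprime-idempotent : ∀ {a b} → Coprime a b → ∃ λ l → ∀ {s} → a · s ≈ ε → (l * b) · s ≈ s
  coprime-idempotent {a} {b} h with coprime-Bézout h
  ... | Bézout.-+ x y eq = y , λ {s} as≈ε → begin
    (y * b) · s          ≡⟨ cong (_· s) eq ⟨
    s ∙ (x * a) · s      ≈⟨ ∙-congˡ (kill-∣ as≈ε (n∣m*n x)) ⟩
    s ∙ ε                ≈⟨ identityʳ s ⟩
    s                    ∎
  -- In this case `y * b` acts as -1 on the `a`-torsion, so its square is taken.
  ... | Bézout.+- x y eq = y * b * y , λ {s} as≈ε →
    let kill : ∀ {s} → a · s ≈ ε → s ∙ (y * b) · s ≈ ε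
        kill {s} as≈ε = ≈-trans (≈-reflexive (cong (_· s) eq)) (kill-∣ as≈ε (n∣m*n x))
        s′ = (y * b) · s
    in ∙-cancelˡ s′ _ _ (begin
      s′ ∙ (y * b * y * b) · s      ≡⟨ cong (λ k → s′ ∙ k · s) (*-assoc (y * b) y b) ⟩
      s′ ∙ (y * b * (y * b)) · s    ≈⟨ ∙-congˡ (×-assocˡ s (y * b) (y * b)) ⟨
      s′ ∙ (y * b) · s′             ≈⟨ kill (kill-· {a} (y * b) as≈ε) ⟩
      ε                             ≈⟨ kill as≈ε ⟨
      s ∙ s′                        ≈⟨ comm s s′ ⟩
      s′ ∙ s                        ∎)

  coprime-unique : ∀ {a b} → Coprime a b → ∀ {s s′ t t′} → a · s ≈ ε → a · s′ ≈ ε →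
                   b · t ≈ ε → b · t′ ≈ ε → s ∙ t ≈ s′ ∙ t′ → s ≈ s′ × t ≈ t′
  coprime-unique {a} {b} h {s} {s′} {t} {t′} as as′ bt bt′ eq =
    s≈s′ , ∙-cancelˡ s _ _ (≈-trans eq (∙-congʳ (≈-sym s≈s′)))
    where
    N = proj₁ (coprime-idempotent h) * b
    project : ∀ {s t} → a · s ≈ ε → b · t ≈ ε → N · (s ∙ t) ≈ s
    project {s} {t} as bt = begin
      N · (s ∙ t)      ≈⟨ ×-distrib-+ s t N ⟩
      N · s ∙ N · t    ≈⟨ ∙-cong (proj₂ (coprime-idempotent h) as)
                               (kill-∣ {b} bt (n∣m*n (proj₁ (coprime-idempotent h)))) ⟩
      s ∙ ε            ≈⟨ identityʳ s ⟩
      s                ∎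
    s≈s′ : s ≈ s′
    s≈s′ = ≈-trans (≈-sym (project as bt)) (≈-trans (×-congʳ N eq) (project as′ bt′))

  -- `s` is the projection of `g`. Since `b · g` is killed by `a`, the projection fixes it; hence
  -- `b · s ≈ b · g`, and the complement of `s` is killed by `b`.
  coprime-split : ∀ {a b} → Coprime a b → ∀ {g} → (a * b) · g ≈ ε →
                  ∃ λ s → ∃ λ t → g ≈ s ∙ t × a · s ≈ ε × b · t ≈ ε
  coprime-split {a} {b} h {g} abg = s , s ⁻¹ ∙ g , g≈st , as , identityʳ-unique (b · s) _ (begin
    b · s ∙ b · (s ⁻¹ ∙ g)   ≈⟨ ×-distrib-+ s (s ⁻¹ ∙ g) b ⟨
    b · (s ∙ (s ⁻¹ ∙ g))     ≈⟨ ×-congʳ b g≈st ⟨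
    b · g                    ≈⟨ proj₂ (coprime-idempotent h) (≈-trans (×-assocˡ g a b) abg) ⟨
    N · (b · g)              ≈⟨ ·-swap N b g ⟩
    b · s                    ∎)
    where
    l = proj₁ (coprime-idempotent h)
    N = l * b
    s = N · g
    g≈st : g ≈ s ∙ (s ⁻¹ ∙ g)
    g≈st = begin
      g                ≈⟨ identityˡ g ⟨
      ε ∙ g            ≈⟨ ∙-congʳ (inverseʳ s) ⟨
      s ∙ s ⁻¹ ∙ g     ≈⟨ assoc s (s ⁻¹) g ⟩
      s ∙ (s ⁻¹ ∙ g)   ∎
    as : a · s ≈ ε
    as = ≈-trans (×-assocˡ g a N) (kill-∣ abg (divides l (eq a l b)))
      where
      eq : ∀ a l b → a * (l * b) ≡ l * (a * b)
      eq = solve-∀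

  subsetSum-cong : ∀ {k} J {f f′ : Fin k → Carrier} → (∀ i → f i ≈ f′ i) → subsetSum G J f ≈ subsetSum G J f′
  subsetSum-cong {zero}  J h = ≈-refl
  subsetSum-cong {suc k} J h with J zero
  ... | true  = ∙-cong (h zero) (subsetSum-cong (J ∘ suc) (h ∘ suc))
  ... | false = ∙-congˡ (subsetSum-cong (J ∘ suc) (h ∘ suc))

  subsetSum-∙ : ∀ {k} J (f f′ : Fin k → Carrier) →
                subsetSum G J (λ i → f i ∙ f′ i) ≈ subsetSum G J f ∙ subsetSum G J f′
  subsetSum-∙ {zero}  J f f′ = ≈-sym (identityˡ ε)
  subsetSum-∙ {suc k} J f f′ with J zero
  ... | true  = ≈-trans (∙-congˡ (subsetSum-∙ (J ∘ suc) (f ∘ suc) (f′ ∘ suc))) (interchange _ _ _ _)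
  ... | false = ≈-trans (∙-cong (≈-sym (identityˡ ε)) (subsetSum-∙ (J ∘ suc) (f ∘ suc) (f′ ∘ suc))) (interchange _ _ _ _)

  subsetSum-· : ∀ {k} J (f : Fin k → ℕ) x → subsetSum G J (λ i → f i · x) ≈ subsetSumℕ J f · x
  subsetSum-· {zero}  J f x = ≈-refl
  subsetSum-· {suc k} J f x with J zero
  ... | true  = ≈-trans (∙-congˡ (subsetSum-· (J ∘ suc) (f ∘ suc) x)) (≈-sym (×-homo-+ x (f zero) _))
  ... | false = ≈-trans (identityˡ _) (subsetSum-· (J ∘ suc) (f ∘ suc) x)

  infix 4 _∈⟨_⟩
  _∈⟨_⟩ : Carrier → Carrier → Set ℓ
  g ∈⟨ x ⟩ = ∃ λ k → g ≈ k · x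

  ∈⟨⟩-trans : ∀ {x y z} → x ∈⟨ y ⟩ → y ∈⟨ z ⟩ → x ∈⟨ z ⟩
  ∈⟨⟩-trans (k , x≈) (l , y≈) = k * l , ≈-trans x≈ (≈-trans (×-congʳ k y≈) (×-assocˡ _ k l))

  kill-∈ : ∀ {m x y} → m · x ≈ ε → y ∈⟨ x ⟩ → m · y ≈ ε
  kill-∈ {m} h (k , y≈) = ≈-trans (×-congʳ m y≈) (kill-· {m} k h)

  -- Subgroups as places for pebbles, and moves between them

  -- A subgroup together with its order, the latter only as the bound on the weight of its pebbles.
  record Place : Set (lsuc (c ⊔ ℓ)) where
    field
      Mem    : Carrier → Set (c ⊔ ℓ)
      order  : ℕ
      resp   : ∀ {x y} → x ≈ y → Mem x → Mem y
      ε-mem  : Mem ε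
      ∙-mem  : ∀ {x y} → Mem x → Mem y → Mem (x ∙ y)

    subsetSum-mem : ∀ {k} J {f : Fin k → Carrier} → (∀ i → Mem (f i)) → Mem (subsetSum G J f)
    subsetSum-mem {zero}  J h = ε-mem
    subsetSum-mem {suc k} J h with J zero
    ... | true  = ∙-mem (h zero) (subsetSum-mem (J ∘ suc) (h ∘ suc))
    ... | false = ∙-mem ε-mem (subsetSum-mem (J ∘ suc) (h ∘ suc))
  open Place

  -- The equation between the orders matches the weights: `suc u` pebbles of weight at most
  -- `1 / order A` have a union of weight at most `1 / order B`.
  Move : ℕ → Place → Place → Set (c ⊔ ℓ)
  Move u A B = order A ≡ suc u * order B
    × (∀ (f : Fin (suc u) → Carrier) → (∀ i → Mem A (f i)) →
       ∃ λ J → (∃ λ i → J i ≡ true) × Mem B (subsetSum G J f))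

  trivial : Place
  trivial = record
    { Mem = λ x → Lift (c ⊔ ℓ) (x ≈ ε) ; order = 1
    ; resp = λ x≈y (lift h) → lift (≈-trans (≈-sym x≈y) h)
    ; ε-mem = lift ≈-refl
    ; ∙-mem = λ (lift h) (lift h′) → lift (≈-trans (∙-cong h h′) (identityˡ ε)) }

  cyclic : Carrier → ℕ → Place
  cyclic x o = record
    { Mem = λ g → Lift (c ⊔ ℓ) (g ∈⟨ x ⟩) ; order = o
    ; resp = λ g≈h (lift (k , g≈)) → lift (k , ≈-trans (≈-sym g≈h) g≈)
    ; ε-mem = lift (0 , ≈-refl)
    ; ∙-mem = λ (lift (k , h)) (lift (k′ , h′)) → lift (k + k′ , ≈-trans (∙-cong h h′) (≈-sym (×-homo-+ x k k′))) }

  infixr 6 _⊗_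
  _⊗_ : Place → Place → Place
  A ⊗ B = record
    { Mem = λ g → ∃ λ s → ∃ λ t → g ≈ s ∙ t × Mem A s × Mem B t
    ; order = order A * order B
    ; resp = λ g≈h (s , t , g≈ , a , b) → s , t , ≈-trans (≈-sym g≈h) g≈ , a , b
    ; ε-mem = ε , ε , ≈-sym (identityˡ ε) , ε-mem A , ε-mem B
    ; ∙-mem = λ (s , t , g≈ , a , b) (s′ , t′ , g≈′ , a′ , b′) →
        s ∙ s′ , t ∙ t′ , ≈-trans (∙-cong g≈ g≈′) (interchange s t s′ t′) , ∙-mem A a a′ , ∙-mem B b b′ }

  module _ {A B k} {f : Fin k → Carrier} (h : ∀ i → Mem (A ⊗ B) (f i)) where
    partˡ partʳ : Fin k → Carrier
    partˡ i = proj₁ (h i)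
    partʳ i = proj₁ (proj₂ (h i))

    partˡ-mem : ∀ i → Mem A (partˡ i)
    partˡ-mem i = proj₁ (proj₂ (proj₂ (proj₂ (h i))))

    partʳ-mem : ∀ i → Mem B (partʳ i)
    partʳ-mem i = proj₂ (proj₂ (proj₂ (proj₂ (h i))))

    subsetSum-parts : ∀ J → subsetSum G J f ≈ subsetSum G J partˡ ∙ subsetSum G J partʳ
    subsetSum-parts J = ≈-trans (subsetSum-cong J (λ i → proj₁ (proj₂ (proj₂ (h i))))) (subsetSum-∙ J partˡ partʳ)

  -- The subset is chosen for the second components; whatever it is, the first components sum to a
  -- member of `A`.
  move-⊗ʳ : ∀ A {u B B′} → Move u B B′ → Move u (A ⊗ B) (A ⊗ B′)
  move-⊗ʳ A {u} {B} {B′} (o , mv) = ≡.trans (cong (order A *_) o) (eq (order A) u (order B′)) , λ f h →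
    let J , ne , b = mv (partʳ {A} {B} h) (partʳ-mem {A} {B} h)
    in J , ne , _ , _ , subsetSum-parts {A} {B} h J , subsetSum-mem A J (partˡ-mem {A} {B} h) , b
    where
    eq : ∀ a u b → a * (suc u * b) ≡ suc u * (a * b)
    eq = solve-∀

  move-⊗ˡ : ∀ B {u A A′} → Move u A A′ → Move u (A ⊗ B) (A′ ⊗ B)
  move-⊗ˡ B {u} {A} {A′} (o , mv) = ≡.trans (cong (_* order B) o) (*-assoc (suc u) (order A′) (order B)) , λ f h →
    let J , ne , a = mv (partˡ {A} {B} h) (partˡ-mem {A} {B} h)
    in J , ne , _ , _ , subsetSum-parts {A} {B} h J , a , subsetSum-mem B J (partʳ-mem {A} {B} h)

  -- The elements are multiples `ks i · x`. A subset whose `ks` add up to a multiple of `suc u` has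
  -- its sum in the group generated by `suc u · x`.
  move-cyclic : ∀ {u x y o} → (suc u · x) ∈⟨ y ⟩ → Move u (cyclic x (suc u * o)) (cyclic y o)
  move-cyclic {u} {x} {y} {o} px∈y = refl , λ f h →
    let ks = λ i → proj₁ (lower (h i))
        J , ne , divides q eq = zero-sum-mod (suc u) ks
    in J , ne , lift (∈⟨⟩-trans (q , (begin
         subsetSum G J f                ≈⟨ subsetSum-cong J (λ i → proj₂ (lower (h i))) ⟩
         subsetSum G J (λ i → ks i · x) ≈⟨ subsetSum-· J ks x ⟩
         subsetSumℕ J ks · x                ≡⟨ cong (_· x) eq ⟩
         (q * suc u) · x                ≈⟨ ×-assocˡ x q (suc u) ⟨
         q · (suc u · x)                ∎)) px∈y)

  LabelEdge : ℕ → Carrier → Carrier → Set ℓ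
  LabelEdge u x y = (suc u · x) ∈⟨ y ⟩

  label-moves : ∀ {k} u (t : Tree k) (lab : Fin k → Carrier) → TreeEdges LabelEdge u t lab →
                TreeEdges Move u t (λ i → cyclic (lab i) (suc u ^ depth t i))
  label-moves u root    lab _        = lift tt
  label-moves u (t ▹ y) lab (e , es) = move-cyclic e , label-moves u t (lab ∘ suc) es

  -- A product of trees of cyclic subgroups for the m-torsion of G.  The divisibility in locate says
  -- that g generates the located subgroup; element shows that G is as large as the pebbling number.
  record Model (m : ℕ) : Set (lsuc (c ⊔ ℓ)) where
    field
      factors   : List Factor
      place     : Vertex factors → Place
      moves     : Edges Move factors place
      at-origin : ∀ {x} → Mem (place (origin factors)) x → x ≈ ε
      order-origin : order (place (origin factors)) ≡ 1
      locate    : ∀ {g} → m · g ≈ ε →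
                  ∃ λ v → Mem (place v) g × (∀ {k} → k · g ≈ ε → order (place v) ∣ k)
      element   : Index factors → Carrier
      killed    : ∀ i → m · element i ≈ ε
      injective : ∀ {i j} → element i ≈ element j → i ≡ j

  unit-model : Model 1
  unit-model = record
    { factors = [] ; place = λ _ → trivial ; moves = lift tt
    ; at-origin = lower ; order-origin = refl
    ; locate = λ h → tt , lift (≈-trans (≈-sym (×-homo-1 _)) h) , λ _ → 1∣ _
    ; element = λ _ → ε ; killed = λ _ → ·-ε 1 ; injective = λ _ → refl }

-- Element orders and decidable membership in a finite group

module FiniteGroup {c ℓ} (G : AbelianGroup c ℓ) (n : ℕ) (e : Fin n → AbelianGroup.Carrier G)
  (enum : IsEnumeration G n e) (ord : AbelianGroup.Carrier G → ℕ)
  (isOrd : ∀ x → IsOrderOf G x (ord x)) where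
  open AbelianGroup G renaming (refl to ≈-refl; sym to ≈-sym; trans to ≈-trans; reflexive to ≈-reflexive)
  open GroupLemmas G
  open Place
  open AbelianGroupProperties G using (identityʳ-unique)

  index : Carrier → Fin n
  index x = proj₁ (proj₂ enum x)

  e-index : ∀ x → e (index x) ≈ x
  e-index x = proj₂ (proj₂ enum x)

  index-injective : ∀ {x y} → index x ≡ index y → x ≈ y
  index-injective {x} {y} eq = ≈-trans (≈-sym (e-index x)) (≈-trans (≈-reflexive (cong e eq)) (e-index y))

  _≈?_ : ∀ x y → Dec (x ≈ y)
  x ≈? y = map′ index-injective
    (λ x≈y → proj₁ enum _ _ (≈-trans (e-index x) (≈-trans x≈y (≈-sym (e-index y)))))
    (index x ≟ index y)

  ord>0 : ∀ x → 0 < ord x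
  ord>0 x = proj₁ (isOrd x)

  instance
    ord≢0 : ∀ {x} → NonZero (ord x)
    ord≢0 {x} = >-nonZero (ord>0 x)

  ord-kills : ∀ x → ord x · x ≈ ε
  ord-kills x = ≈-trans (≈-reflexive (≡.sym (•≡· (ord x) x))) (proj₁ (proj₂ (isOrd x)))

  ord-minimal : ∀ {x k} → k · x ≈ ε → k < ord x → k ≡ 0
  ord-minimal {x} {zero}  h k< = refl
  ord-minimal {x} {suc k} h k< = contradiction (≈-trans (≈-reflexive (•≡· (suc k) x)) h)
    (proj₂ (proj₂ (isOrd x)) (suc k) (s≤s z≤n) k<)

  %-ord : ∀ x k → k · x ≈ (k % ord x) · x
  %-ord x k = ≈-trans (≈-reflexive (cong (_· x) (m≡m%n+[m/n]*n k (ord x))))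
    (≈-trans (×-homo-+ x (k % ord x) _) (≈-trans (∙-congˡ (kill-∣ (ord-kills x) (n∣m*n (k / ord x)))) (identityʳ _)))

  ord-∣ : ∀ {x k} → k · x ≈ ε → ord x ∣ k
  ord-∣ {x} {k} h = divides (k / ord x) (≡.trans (m≡m%n+[m/n]*n k (ord x))
    (cong (_+ k / ord x * ord x) (ord-minimal (≈-trans (≈-sym (%-ord x k)) h) (m%n<n k (ord x)))))

  ord-mono : ∀ {x y} → x ∈⟨ y ⟩ → ord x ∣ ord y
  ord-mono {x} {y} h = ord-∣ (kill-∈ {ord y} (ord-kills y) h)

  ord-≡ : ∀ {x y} → x ∈⟨ y ⟩ → y ∈⟨ x ⟩ → ord x ≡ ord y
  ord-≡ h h′ = ∣-antisym (ord-mono h) (ord-mono h′)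

  ≈⇒∈ : ∀ {x y} → x ≈ y → x ∈⟨ y ⟩
  ≈⇒∈ x≈y = 1 , ≈-trans x≈y (≈-sym (×-homo-1 _))

  ord-cong : ∀ {x y} → x ≈ y → ord x ≡ ord y
  ord-cong x≈y = ord-≡ (≈⇒∈ x≈y) (≈⇒∈ (≈-sym x≈y))

  -- Multipliers can be reduced modulo `ord x`, which leaves finitely many to test.
  _∈⟨_⟩? : ∀ g x → Dec (g ∈⟨ x ⟩)
  g ∈⟨ x ⟩? = map′ (λ (k , h) → toℕ k , h)
    (λ (k , h) → fromℕ< (m%n<n k (ord x)) , ≈-trans h (≈-trans (%-ord x k)
       (≈-reflexive (cong (_· x) (≡.sym (toℕ-fromℕ< (m%n<n k (ord x))))))))
    (any? (λ (k : Fin (ord x)) → g ≈? (toℕ k · x)))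

  ·-injective-≤ : ∀ {x k l} → k ≤ l → l < ord x → k · x ≈ l · x → k ≡ l
  ·-injective-≤ {x} {k} {l} k≤l l< eq = ≤-antisym k≤l (m∸n≡0⇒m≤n (ord-minimal
    (identityʳ-unique (k · x) ((l ∸ k) · x) (≈-trans (≈-sym (×-homo-+ x k (l ∸ k)))
      (≈-trans (≈-reflexive (cong (_· x) (m+[n∸m]≡n k≤l))) (≈-sym eq))))
    (≤-<-trans (m∸n≤m l k) l<)))

  ·-injective : ∀ {x k l} → k < ord x → l < ord x → k · x ≈ l · x → k ≡ l
  ·-injective {k = k} {l} k< l< eq with ≤-total k l
  ... | inj₁ k≤l = ·-injective-≤ k≤l l< eq
  ... | inj₂ l≤k = ≡.sym (·-injective-≤ l≤k k< (≈-sym eq))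

  ord-p· : ∀ p {x o} .{{_ : NonZero p}} → ord x ≡ p * o → ord (p · x) ≡ o
  ord-p· p {x} {o} eq = ∣-antisym
    (ord-∣ (≈-trans (×-assocˡ x o p) (≈-trans (≈-reflexive (cong (_· x) (≡.trans (*-comm o p) (≡.sym eq)))) (ord-kills x))))
    (*-cancelˡ-∣ p (subst (_∣ p * ord (p · x)) eq (ord-∣
      (≈-trans (≈-reflexive (cong (_· x) (*-comm p (ord (p · x)))))
        (≈-trans (≈-sym (×-assocˡ x (ord (p · x)) p)) (ord-kills (p · x)))))))

  -- The tree of cyclic subgroups of the `p`-primary part

  module PrimePart (u : ℕ) (prime : Prime (suc u)) (α : ℕ) where
    p : ℕ
    p = suc u

    -- A partial tree, grown one leaf at a time. `element` is carried along because its injectivity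
    -- bounds `size` by the number of group elements.
    record LabelledTree : Set (c ⊔ ℓ) where
      field
        {k}         : ℕ
        tree        : Tree k
        lab         : Fin k → Carrier
        lab-edges   : TreeEdges LabelEdge u tree lab
        lab-root    : lab (rootOf tree) ≈ ε
        lab-killed  : ∀ x → (p ^ α) · lab x ≈ ε
        lab-ord     : ∀ x → ord (lab x) ≡ p ^ depth tree x
        element     : TreeIndex u tree → Carrier
        element-in  : ∀ i → ∃ λ x → element i ∈⟨ lab x ⟩ × ord (element i) ≡ p ^ depth tree x
        element-inj : ∀ {i j} → element i ≈ element j → i ≡ j
    open LabelledTree

    -- s generates one of the cyclic groups in the tree.
    Covers : LabelledTree → Carrier → Set ℓ
    Covers T s = ∃ λ x → s ∈⟨ lab T x ⟩ × ord s ≡ p ^ depth (tree T) x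

    covers? : ∀ T s → Dec (Covers T s)
    covers? T s = any? (λ x → (s ∈⟨ lab T x ⟩?) ×-dec (ord s ℕ.≟ p ^ depth (tree T) x))

    covers-resp : ∀ T {s s′} → s ≈ s′ → Covers T s → Covers T s′
    covers-resp T s≈s′ (x , s∈ , eq) = x , ∈⟨⟩-trans (≈⇒∈ (≈-sym s≈s′)) s∈ , ≡.trans (ord-cong (≈-sym s≈s′)) eq

    ord-ε : ord ε ≡ 1
    ord-ε = ∣1⇒≡1 (ord-∣ (×-homo-1 ε))

    seed : LabelledTree
    seed = record
      { tree = root ; lab = λ _ → ε ; lab-edges = lift tt ; lab-root = ≈-refl
      ; lab-killed = λ _ → ·-ε (p ^ α) ; lab-ord = λ _ → ord-ε
      ; element = λ _ → ε ; element-in = λ _ → zero , (0 , ≈-refl) , ord-ε ; element-inj = λ _ → refl }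

    module Generators {s} (d : ℕ) (ord-s : ord s ≡ p ^ suc d) where
      exponent : Fin (p ^ d) × Fin u → ℕ
      -- The value is `p * j + i + 1`; the `suc` skips the multiples of `p`.
      exponent (j , i) = toℕ (combine j (suc i))

      exponent< : ∀ x → exponent x < ord s
      exponent< (j , i) = ≤-trans (toℕ<n (combine j (suc i))) (≤-reflexive (≡.trans (*-comm (p ^ d) p) (≡.sym ord-s)))

      exponent-coprime : ∀ x → Coprime (p ^ suc d) (exponent x)
      exponent-coprime (j , i) = Coprimality.sym (coprime-^ʳ (suc d) (prime∤⇒coprime prime λ p∣ →
        contradiction (∣⇒≤ (∣m+n∣m⇒∣n (subst (p ∣_) (toℕ-combine j (suc i)) p∣) (m∣m*n (toℕ j))))
                      (<⇒≱ (toℕ<n (suc i)))))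

      generator : Fin (p ^ d) × Fin u → Carrier
      generator x = exponent x · s

      generates : ∀ x → s ∈⟨ generator x ⟩
      generates x with coprime-idempotent (exponent-coprime x)
      ... | l , h = l , ≈-sym (≈-trans (×-assocˡ s l (exponent x))
        (h (≈-trans (≈-reflexive (cong (_· s) (≡.sym ord-s))) (ord-kills s))))

      generator-inj : ∀ {x y} → generator x ≈ generator y → x ≡ y
      generator-inj {j , i} {j′ , i′} eq with combine-injective j (suc i) j′ (suc i′)
        (toℕ-injective (·-injective (exponent< (j , i)) (exponent< (j′ , i′)) eq))
      ... | refl , refl = refl

    -- `¬ Covers T s` keeps `element` injective: an old element equal to a generator of the group of
    -- `s` would put `s` into an old cyclic subgroup of the same order.
    extend : ∀ T {s} → (p ^ α) · s ≈ ε → ∀ y → (p · s) ∈⟨ lab T y ⟩ →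
             ord s ≡ p ^ suc (depth (tree T) y) → ¬ Covers T s → LabelledTree
    extend T {s} killed y ps∈ ord-s ¬cov = record
      { tree = tree T ▹ y
      ; lab = λ { zero → s ; (suc x) → lab T x }
      ; lab-edges = ps∈ , lab-edges T
      ; lab-root = lab-root T
      ; lab-killed = λ { zero → killed ; (suc x) → lab-killed T x }
      ; lab-ord = λ { zero → ord-s ; (suc x) → lab-ord T x }
      ; element = element′
      ; element-in = λ { (inj₁ i) → let x , h = element-in T i in suc x , h
                       ; (inj₂ x) → zero , (exponent x , ≈-refl)
                                  , ≡.trans (ord-≡ (exponent x , ≈-refl) (generates x)) ord-s }
      ; element-inj = λ {i} {j} → element′-inj i j }
      where
      open Generators (depth (tree T) y) ord-s
      element′ : TreeIndex u (tree T ▹ y) → Carrier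
      element′ (inj₁ i) = element T i
      element′ (inj₂ x) = generator x
      new : ∀ i x → ¬ element T i ≈ generator x
      new i x eq = let x′ , el∈ , o = element-in T i in
        ¬cov (x′ , ∈⟨⟩-trans (∈⟨⟩-trans (generates x) (≈⇒∈ (≈-sym eq))) el∈
             , ≡.trans (ord-≡ (generates x) (exponent x , ≈-refl)) (≡.trans (ord-cong (≈-sym eq)) o))
      element′-inj : ∀ i j → element′ i ≈ element′ j → i ≡ j
      element′-inj (inj₁ i) (inj₁ j) eq = cong inj₁ (element-inj T eq)
      element′-inj (inj₁ i) (inj₂ y) eq = contradiction eq (new i y)
      element′-inj (inj₂ x) (inj₁ j) eq = contradiction (≈-sym eq) (new j x)
      element′-inj (inj₂ x) (inj₂ y) eq = cong inj₂ (generator-inj eq)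

    Extension : LabelledTree → LabelledTree → Set (c ⊔ ℓ)
    Extension T T′ = ∀ {s} → Covers T s → Covers T′ s

    depth-root : ∀ {k} (t : Tree k) → depth t (rootOf t) ≡ 0
    depth-root root    = refl
    depth-root (t ▹ y) = depth-root t

    -- Recursion along `s`, `p · s`, and so on down to the identity: once `p · s` is covered at `y`,
    -- either `s` is covered as well or it becomes a new leaf attached to `y`.
    cover : ∀ d T {s} → (p ^ α) · s ≈ ε → ord s ≡ p ^ d → ∃ λ T′ → Extension T T′ × Covers T′ s
    cover zero    T {s} killed ord-s = T , (λ z → z) , rootOf (tree T)
      , (0 , ≈-trans (≈-sym (×-homo-1 s)) (≈-trans (≈-reflexive (cong (_· s) (≡.sym ord-s))) (ord-kills s)))
      , ≡.trans ord-s (cong (p ^_) (≡.sym (depth-root (tree T))))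
    cover (suc d) T {s} killed ord-s
      with cover d T {p · s} (kill-· {p ^ α} p killed) (ord-p· p ord-s)
    ... | T₁ , T⊆T₁ , y , ps∈ , ord-ps with covers? T₁ s
    ...   | yes cov = T₁ , T⊆T₁ , cov
    ...   | no ¬cov = extend T₁ killed y ps∈ ord-s′ ¬cov
                    , (λ cov → let x , h = T⊆T₁ cov in suc x , h)
                    , zero , ≈⇒∈ ≈-refl , ord-s′
      where
      ord-s′ : ord s ≡ p ^ suc (depth (tree T₁) y)
      ord-s′ = ≡.trans ord-s (cong (p *_) (≡.trans (≡.sym (ord-p· p ord-s)) ord-ps))

    cover-all : ∀ {m} (f : Fin m → Carrier) →
                ∃ λ T → ∀ i → (p ^ α) · f i ≈ ε → Covers T (f i)
    cover-all {zero}  f = seed , λ ()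
    cover-all {suc m} f with cover-all (f ∘ suc) | ((p ^ α) · f zero) ≈? ε
    ... | T , cov | no ¬killed = T , λ { zero h → contradiction h ¬killed ; (suc i) h → cov i h }
    ... | T , cov | yes killed with ∣-prime-power prime α (ord-∣ killed)
    ...   | d , ord≡ with cover d T killed ord≡
    ...     | T′ , T⊆T′ , cov₀ = T′ , λ { zero _ → cov₀ ; (suc i) h → T⊆T′ (cov i h) }

    full : LabelledTree
    full = proj₁ (cover-all e)

    covers-full : ∀ {s} → (p ^ α) · s ≈ ε → Covers full s
    covers-full {s} h = covers-resp full (e-index s)
      (proj₂ (cover-all e) (index s) (≈-trans (×-congʳ (p ^ α) (e-index s)) h))

    -- Components in the `p ^ α`-torsion and the `m`-torsion are unique by `coprime-unique`. This
    -- gives the injectivity of `element` and the divisibility in `locate`.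
    product-model : ∀ {m} → Coprime (p ^ α) m → Model m → Model (p ^ α * m)
    product-model {m} cop Q = record
      { factors = factor u (tree full) ∷ Model.factors Q
      ; place = place′
      ; moves = (λ i → map-edges {h = treePlace i ⊗_} (λ {u} {A} {B} → move-⊗ʳ (treePlace i) {u} {A} {B})
                                 (Model.factors Q) (Model.moves Q))
              , (λ v → map-treeEdges {h = _⊗ Model.place Q v} (λ {u} {A} {B} → move-⊗ˡ (Model.place Q v) {u} {A} {B})
                                     u (tree full) (label-moves u (tree full) (lab full) (lab-edges full)))
      ; at-origin = λ { (s , t , x≈ , lift (k , s≈) , t∈) → ≈-trans x≈ (≈-trans (∙-cong
            (≈-trans s≈ (≈-trans (×-congʳ k (lab-root full)) (·-ε k))) (Model.at-origin Q t∈)) (identityˡ ε)) }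
      ; order-origin = cong₂ _*_ (cong (p ^_) (depth-root (tree full))) (Model.order-origin Q)
      ; locate = locate′
      ; element = λ (i , j) → element full i ∙ Model.element Q j
      ; killed = λ (i , j) → kills (element-killed i) (Model.killed Q j)
      ; injective = λ {x} {y} → injective′ x y
      }
      where
      treePlace : Fin (k full) → Place
      treePlace i = cyclic (lab full i) (p ^ depth (tree full) i)
      place′ : Vertex (factor u (tree full) ∷ Model.factors Q) → Place
      place′ (i , v) = treePlace i ⊗ Model.place Q v
      kills : ∀ {s t} → (p ^ α) · s ≈ ε → m · t ≈ ε → (p ^ α * m) · (s ∙ t) ≈ ε
      kills {s} {t} hs ht = ≈-trans (×-distrib-+ s t (p ^ α * m))
        (≈-trans (∙-cong (kill-∣ {p ^ α} hs (m∣m*n m)) (kill-∣ {m} ht (n∣m*n (p ^ α)))) (identityˡ ε))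
      element-killed : ∀ i → (p ^ α) · element full i ≈ ε
      element-killed i = let x , el∈ , _ = element-in full i in kill-∈ {p ^ α} (lab-killed full x) el∈
      injective′ : ∀ x y → element full (proj₁ x) ∙ Model.element Q (proj₂ x)
                         ≈ element full (proj₁ y) ∙ Model.element Q (proj₂ y) → x ≡ y
      injective′ (i , j) (i′ , j′) eq =
        let s≈ , t≈ = coprime-unique cop (element-killed i) (element-killed i′) (Model.killed Q j) (Model.killed Q j′) eq
        in cong₂ _,_ (element-inj full s≈) (Model.injective Q t≈)
      locate′ : ∀ {g} → (p ^ α * m) · g ≈ ε →
                ∃ λ v → Mem (place′ v) g × (∀ {k} → k · g ≈ ε → order (place′ v) ∣ k)
      locate′ {g} h with coprime-split cop h
      ... | s , t , g≈ , hs , ht with covers-full hs | Model.locate Q ht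
      ...   | i , s∈ , ord-s | v , t∈ , ord-t = (i , v) , (s , t , g≈ , lift s∈ , t∈) , λ {k} kg →
        -- Comparing `k · g` with `ε ∙ ε` shows that `k` kills both components; their coprime orders
        -- then divide `k` together.
        let ks≈ , kt≈ = coprime-unique cop (kill-· {p ^ α} k hs) (·-ε (p ^ α)) (kill-· {m} k ht) (·-ε m)
              (≈-trans (≈-sym (×-distrib-+ s t k)) (≈-trans (×-congʳ k (≈-sym g≈)) (≈-trans kg (≈-sym (identityˡ ε)))))
        in coprime-*-∣ (coprime-∣ cop (subst (_∣ p ^ α) ord-s (ord-∣ hs)) (ord-t ht))
             (subst (_∣ k) ord-s (ord-∣ ks≈)) (ord-t kt≈)

-- Counting generators, and splitting off primes

TreeIndex↔ : ∀ {k} u (t : Tree k) → Fin (size u t) ↔ TreeIndex u t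
TreeIndex↔ u root    = 1↔⊤
TreeIndex↔ u (t ▹ y) = (TreeIndex↔ u t ⊎-↔
  subst (λ m → Fin m ↔ (Fin (suc u ^ depth t y) × Fin u)) (*-comm (suc u ^ depth t y) u) *↔×) ↔-∘ +↔⊎

Index↔ : ∀ fs → Fin (Num fs) ↔ Index fs
Index↔ []       = 1↔⊤
Index↔ (F ∷ fs) = (TreeIndex↔ (Factor.u F) (Factor.tree F) ×-↔ Index↔ fs) ↔-∘ *↔×

split-prime : ∀ {p} → Prime p → ∀ m → 0 < m → ∃ λ a → ∃ λ m′ → m ≡ p ^ a * m′ × ¬ p ∣ m′
split-prime {p} pr = <-rec _ step
  where
  step : ∀ m → (∀ {m₁} → m₁ < m → 0 < m₁ → ∃ λ a → ∃ λ m′ → m₁ ≡ p ^ a * m′ × ¬ p ∣ m′) →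
         0 < m → ∃ λ a → ∃ λ m′ → m ≡ p ^ a * m′ × ¬ p ∣ m′
  step m rec 0<m with p ∣? m
  ... | no p∤m = 0 , m , ≡.sym (*-identityˡ m) , p∤m
  ... | yes p∣m with rec (quotient-< p∣m {{prime⇒nonTrivial pr}} {{>-nonZero 0<m}})
                         (>-nonZero⁻¹ _ {{quotient≢0 p∣m {{>-nonZero 0<m}}}})
  ...   | a , m′ , eq , p∤m′ = suc a , m′
    , ≡.trans (m∣n⇒n≡m*quotient p∣m) (≡.trans (cong (p *_) eq) (≡.sym (*-assoc p (p ^ a) m′))) , p∤m′

prime-divisor : ∀ m → 1 < m → ∃ λ p → Prime p × p ∣ m
prime-divisor m@(suc _) 1<m with factorise m
... | record { factors = [] ; isFactorisation = eq } = contradiction 1<m (subst (λ x → ¬ 1 < x) (≡.sym eq) 1+n≰n)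
... | record { factors = p ∷ ps ; isFactorisation = eq ; factorsPrime = pr ∷ _ } =
  p , pr , subst (p ∣_) (≡.sym eq) (m∣m*n (product ps))

-- Sums of reciprocals over a common denominator

-- Each `recip (o i)` equals `κ i / suc l`. Unnormalised rationals keep this denominator without
-- reduction.
subsetSumℚ-subsetSumℕ : ∀ l {n} (K : Fin n → Bool) (o κ : Fin n → ℕ) → (∀ i → suc l ≡ κ i * o i) →
                    toℚᵘ (subsetSumℚ K (λ i → recip (o i))) ≃ mkℚᵘ (ℤ.+ subsetSumℕ K κ) l
subsetSumℚ-subsetSumℕ l {zero}  K o κ h = *≡* refl
subsetSumℚ-subsetSumℕ l {suc n} K o κ h = begin
  toℚᵘ (x +ℚ subsetSumℚ (K ∘ suc) (λ i → recip (o (suc i))))          ≈⟨ toℚᵘ-homo-+ x _ ⟩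
  toℚᵘ x +ᵘ toℚᵘ (subsetSumℚ (K ∘ suc) (λ i → recip (o (suc i))))
    ≈⟨ ℚᵘₚ.+-cong x≃ (subsetSumℚ-subsetSumℕ l (K ∘ suc) (o ∘ suc) (κ ∘ suc) (h ∘ suc)) ⟩
  mkℚᵘ (ℤ.+ a) l +ᵘ mkℚᵘ (ℤ.+ b) l                                   ≈⟨ *≡* add ⟩
  mkℚᵘ (ℤ.+ (a + b)) l                                                 ∎
  where
  open SetoidReasoning ℚᵘₚ.≃-setoid
  x = if K zero then recip (o zero) else 0ℚ
  a = if K zero then κ zero else 0
  b = subsetSumℕ (K ∘ suc) (κ ∘ suc)
  recip≃ : ∀ o κ → suc l ≡ κ * o → toℚᵘ (recip o) ≃ mkℚᵘ (ℤ.+ κ) l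
  recip≃ zero    κ eq = contradiction (≡.trans eq (*-zeroʳ κ)) λ ()
  recip≃ (suc o) κ eq = ℚᵘₚ.≃-trans (toℚᵘ-fromℚᵘ (mkℚᵘ (ℤ.+ 1) o))
    (*≡* (≡.trans (ℤₚ.*-identityˡ (ℤ.+ suc l)) (≡.trans (cong ℤ.+_ eq) (ℤₚ.pos-* κ (suc o)))))
  x≃ : toℚᵘ x ≃ mkℚᵘ (ℤ.+ a) l
  x≃ with K zero
  ... | true  = recip≃ (o zero) (κ zero) (h zero)
  ... | false = *≡* refl
  L = ℤ.+ suc l
  add : (ℤ.+ a ℤ.* L ℤ.+ ℤ.+ b ℤ.* L) ℤ.* L ≡ ℤ.+ (a + b) ℤ.* (L ℤ.* L)
  add = ≡.trans (cong (ℤ._* L) (≡.sym (ℤₚ.*-distribʳ-+ L (ℤ.+ a) (ℤ.+ b)))) (ℤₚ.*-assoc (ℤ.+ (a + b)) L L)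

subsetSumℚ≤1 : ∀ l {n} (K : Fin n → Bool) (o κ : Fin n → ℕ) → (∀ i → suc l ≡ κ i * o i) →
               subsetSumℕ K κ ≤ suc l → subsetSumℚ K (λ i → recip (o i)) ≤ℚ 1ℚ
subsetSumℚ≤1 l K o κ h le = toℚᵘ-cancel-≤ (ℚᵘₚ.≤-respˡ-≃ (ℚᵘₚ.≃-sym (subsetSumℚ-subsetSumℕ l K o κ h))
  (*≤* (≡.subst₂ ℤ._≤_ (≡.sym (ℤₚ.*-identityʳ _)) (≡.sym (ℤₚ.*-identityˡ _)) (ℤ.+≤+ le))))

-- Index sets as resources of an affine separation logic

module Resources (o : Level) (n : ℕ) where
  -- With multiplicities in place of subsets, disjointness becomes a bound on a sum: starting from
  -- multiplicity one at every index, all that can be derived has multiplicities 0 and 1.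
  Resource : Set
  Resource = Fin n → ℕ

  Assertion : Set (lsuc o)
  Assertion = Resource → Set o

  infix 4 _⊑_ _⊩_
  _⊑_ : Resource → Resource → Set
  Y ⊑ X = ∀ i → Y i ≤ X i

  _⊩_ : Assertion → Assertion → Set o
  A ⊩ B = ∀ {X} → A X → ∃ λ Y → Y ⊑ X × B Y

  infixr 6 _✶_
  -- Separating conjunction; the inequality allows indices to be thrown away.
  _✶_ : Assertion → Assertion → Assertion
  (A ✶ B) X = ∃ λ Y → ∃ λ Z → (λ i → Y i + Z i) ⊑ X × A Y × B Z

  emp : Assertion
  emp X = Lift o ⊤

  ⊩-refl : ∀ {A} → A ⊩ A
  ⊩-refl a = _ , (λ i → ≤-refl) , a

  ⊩-trans : ∀ {A B C} → A ⊩ B → B ⊩ C → A ⊩ C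
  ⊩-trans f g a with f a
  ... | Y , Y⊑X , b with g b
  ...   | Z , Z⊑Y , c = Z , (λ i → ≤-trans (Z⊑Y i) (Y⊑X i)) , c

  ✶-mono : ∀ {A A′ B B′} → A ⊩ A′ → B ⊩ B′ → (A ✶ B) ⊩ (A′ ✶ B′)
  ✶-mono f g (Y , Z , h , a , b) with f a | g b
  ... | Y′ , hY , a′ | Z′ , hZ , b′ =
    _ , (λ i → ≤-trans (+-mono-≤ (hY i) (hZ i)) (h i)) , Y′ , Z′ , (λ i → ≤-refl) , a′ , b′

  ✶-assocʳ : ∀ {A B C} → ((A ✶ B) ✶ C) ⊩ (A ✶ (B ✶ C))
  ✶-assocʳ (_ , Z , h , (X , Y , h′ , a , b) , c) = _ , (λ i → ≤-refl) , X , (λ i → Y i + Z i)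
    , (λ i → ≤-trans (≤-reflexive (≡.sym (+-assoc (X i) (Y i) (Z i)))) (≤-trans (+-monoˡ-≤ (Z i) (h′ i)) (h i)))
    , a , Y , Z , (λ i → ≤-refl) , b , c

  ✶-assocˡ : ∀ {A B C} → (A ✶ (B ✶ C)) ⊩ ((A ✶ B) ✶ C)
  ✶-assocˡ (X , _ , h , a , Y , Z , h′ , b , c) = _ , (λ i → ≤-refl) , (λ i → X i + Y i) , Z
    , (λ i → ≤-trans (≤-reflexive (+-assoc (X i) (Y i) (Z i))) (≤-trans (+-monoʳ-≤ (X i) (h′ i)) (h i)))
    , (X , Y , (λ i → ≤-refl) , a , b) , c

  ✶-comm : ∀ {A B} → (A ✶ B) ⊩ (B ✶ A)
  ✶-comm (Y , Z , h , a , b) = _ , (λ i → ≤-refl) , Z , Y , (λ i → ≤-trans (≤-reflexive (+-comm (Z i) (Y i))) (h i)) , b , a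

  emp-elim : ∀ {A} → (emp ✶ A) ⊩ A
  emp-elim (Y , Z , h , _ , a) = Z , (λ i → ≤-trans (m≤n+m (Z i) (Y i)) (h i)) , a

  emp-intro : ∀ {A} → A ⊩ (emp ✶ A)
  emp-intro a = _ , (λ i → ≤-refl) , (λ _ → 0) , _ , (λ i → ≤-refl) , lift tt , a

  assertions : CommutativeMonoid (lsuc o) o
  assertions = record
    { Carrier = Assertion
    ; _≈_ = λ A B → (A ⊩ B) × (B ⊩ A)
    ; _∙_ = _✶_
    ; ε = emp
    ; isCommutativeMonoid = record
      { isMonoid = record
        { isSemigroup = record
          { isMagma = record
            { isEquivalence = record
              { refl  = ⊩-refl , ⊩-refl
              ; sym   = λ (f , g) → g , f
              ; trans = λ (f , g) (f′ , g′) → ⊩-trans f f′ , ⊩-trans g′ g }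
            ; ∙-cong = λ (f , g) (f′ , g′) → ✶-mono f f′ , ✶-mono g g′ }
          ; assoc = λ _ _ _ → ✶-assocʳ , ✶-assocˡ }
        ; identity = (λ _ → emp-elim , emp-intro)
                   , (λ _ → ⊩-trans ✶-comm emp-elim , ⊩-trans emp-intro ✶-comm) }
      ; comm = λ _ _ → ✶-comm , ✶-comm } }

  affine : AffineMonoid (lsuc o) o o
  affine = record
    { commutativeMonoid = assertions
    ; _⊢_ = _⊩_
    ; reflexive = proj₁
    ; ⊢-trans = ⊩-trans
    ; ⊕-mono = ✶-mono
    ; discard = λ _ _ → _ , (λ i → ≤-refl) , lift tt }

  open AffineMonoid affine

  ·-split : ∀ k {A X} → (k · A) X → ∃ λ (f : Fin k → Resource) →
            (∀ i → 𝐍.sum (λ j → f j i) ≤ X i) × (∀ j → A (f j))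
  ·-split zero    _ = (λ ()) , (λ i → z≤n) , (λ ())
  ·-split (suc k) (Y , Z , h , a , as) with ·-split k as
  ... | f , hf , af = (λ { zero → Y ; (suc j) → f j })
                    , (λ i → ≤-trans (+-monoʳ-≤ (Y i) (hf i)) (h i))
                    , (λ { zero → a ; (suc j) → af j })

  sum-intro : ∀ {k} {A : Fin k → Assertion} (f : Fin k → Resource) → (∀ j → A j (f j)) →
              sum A (λ i → 𝐍.sum (λ j → f j i))
  sum-intro {zero}  f h = lift tt
  sum-intro {suc k} f h = f zero , _ , (λ i → ≤-refl) , h zero , sum-intro (f ∘ suc) (h ∘ suc)

subsetSumℕ≤sum : ∀ {k} J (f : Fin k → ℕ) → subsetSumℕ J f ≤ 𝐍.sum f
subsetSumℕ≤sum {zero}  J f = z≤n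
subsetSumℕ≤sum {suc k} J f with J zero
... | true  = +-monoʳ-≤ (f zero) (subsetSumℕ≤sum (J ∘ suc) (f ∘ suc))
... | false = ≤-trans (subsetSumℕ≤sum (J ∘ suc) (f ∘ suc)) (m≤n+m _ (f zero))

≤subsetSumℕ : ∀ {k} J (f : Fin k → ℕ) j → J j ≡ true → f j ≤ subsetSumℕ J f
≤subsetSumℕ J f zero    eq rewrite eq = m≤m+n (f zero) _
≤subsetSumℕ J f (suc j) eq = ≤-trans (≤subsetSumℕ (J ∘ suc) (f ∘ suc) j eq) (m≤n+m _ _)

sum-bound : ∀ {k} (f : Fin k → ℕ) a b → (∀ i → a * f i ≤ b) → a * 𝐍.sum f ≤ k * b
sum-bound {zero}  f a b h = ≤-reflexive (*-zeroʳ a)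
sum-bound {suc k} f a b h = ≤-trans (≤-reflexive (*-distribˡ-+ a (f zero) _))
  (+-mono-≤ (h zero) (sum-bound (f ∘ suc) a b (h ∘ suc)))

-- Placing the initial pebbles

δᵛ : ∀ fs → Vertex fs → Config fs
δᵛ []       _       _       = 1
δᵛ (F ∷ fs) (i , v) (j , w) = δ i j * δᵛ fs v w

total-δᵛ : ∀ fs v → total fs (δᵛ fs v) ≡ 1
total-δᵛ []       v       = refl
total-δᵛ (F ∷ fs) (i , v) = ≡.trans
  (𝐍.sum-cong-≋ {Factor.k F} (λ j → ≡.trans (total-* fs (δ i j) (δᵛ fs v)) (≡.sym (·≡* (δ i j) _))))
  (≡.trans (𝐍.sum-δ i (λ _ → total fs (δᵛ fs v))) (total-δᵛ fs v))

module Placement {a b o} (𝓐 : AffineMonoid a b o) where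
  open AffineMonoid 𝓐
  open Pebbling 𝓐

  val-δᵛ : ∀ fs P v → val fs P (δᵛ fs v) ≈ P v
  val-δᵛ []       P v       = ×-homo-1 _
  val-δᵛ (F ∷ fs) P (i , v) = ≈-trans
    (sum-cong-≋ {Factor.k F} (λ j → ≈-trans
      (∑-cong fs (λ w → ≈-sym (×-assocˡ (P (j , w)) (δ i j) (δᵛ fs v w))))
      (∑-· fs (δ i j) (λ w → δᵛ fs v w · P (j , w)))))
    (≈-trans (sum-δ i (λ j → val fs (λ w → P (j , w)) (δᵛ fs v))) (val-δᵛ fs (λ w → P (i , w)) v))

  place-all : ∀ fs P {m} (f : Fin m → Vertex fs) →
              ∃ λ c → total fs c ≡ m × sum (λ i → P (f i)) ⊢ val fs P c
  place-all fs P {zero}  f = (λ _ → 0) , 𝐍.∑-0 fs (λ _ → refl) , reflexive (≈-sym (∑-0 fs (λ _ → ≈-refl)))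
  place-all fs P {suc m} f with place-all fs P (f ∘ suc)
  ... | c , tot , h = (λ v → δᵛ fs (f zero) v + c v)
    , ≡.trans (𝐍.∑-⊕ fs (δᵛ fs (f zero)) c) (cong₂ _+_ (total-δᵛ fs (f zero)) tot)
    , (⊕-mono (reflexive (≈-sym (val-δᵛ fs P (f zero)))) h
       ⟫ reflexive (≈-sym (≈-trans (∑-cong fs (λ v → ×-homo-+ (P v) (δᵛ fs (f zero) v) (c v)))
                                   (∑-⊕ fs (λ v → δᵛ fs (f zero) v · P v) (λ v → c v · P v)))))

-- Models for every `m`, one prime at a time

module ModelExistence {c ℓ} (G : AbelianGroup c ℓ) (n : ℕ) (e : Fin n → AbelianGroup.Carrier G)
  (enum : IsEnumeration G n e) (ord : AbelianGroup.Carrier G → ℕ)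
  (isOrd : ∀ x → IsOrderOf G x (ord x)) {a b o} (𝓐 : AffineMonoid a b o) where
  open GroupLemmas G
  open FiniteGroup G n e enum ord isOrd
  open Pebbling 𝓐

  coprime-^ : ∀ {p m} → Prime p → ¬ p ∣ m → ∀ α → Coprime (p ^ α) m
  coprime-^ pr p∤m α = Coprimality.sym (coprime-^ʳ α (prime∤⇒coprime pr p∤m))

  OddSolution : ℕ → Set _
  OddSolution m = Σ (Model m) λ Q → Small (Model.factors Q) × One (Model.factors Q) × Two (Model.factors Q)

  odd-step : ∀ {m} p → Prime p → ¬ p ≡ 2 → ∀ α → ¬ p ∣ m → OddSolution m → OddSolution (p ^ α * m)
  odd-step zero pr _ α p∤m _ = contradiction pr ¬prime[0]
  odd-step (suc zero) pr _ α p∤m _ = contradiction pr ¬prime[1]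
  odd-step (suc (suc zero)) pr ≢2 α p∤m _ = contradiction refl ≢2
  odd-step (suc (suc (suc w))) pr _ α p∤m (Q , small , one , two) =
    product-model (coprime-^ pr p∤m α) Q
    , small-∷ w (LabelledTree.tree full) (Model.factors Q) small
    , one-step (LabelledTree.tree full) , two-step (LabelledTree.tree full)
    where
    open PrimePart (suc (suc w)) pr α
    open Step (Model.factors Q) (suc w) small one two

  -- Strong induction: the full power of some prime divisor is split off, so that the cofactor is
  -- smaller, odd and coprime to it.
  odd-solution : ∀ m → ¬ 2 ∣ m → OddSolution m
  odd-solution = <-rec _ step
    where
    step : ∀ m → (∀ {m′} → m′ < m → ¬ 2 ∣ m′ → OddSolution m′) → ¬ 2 ∣ m → OddSolution m
    step zero          rec odd = contradiction (2 ∣0) odd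
    step (suc zero)    rec odd = unit-model , ≤-refl , one-[] , two-[]
    step m@(suc (suc _)) rec odd with prime-divisor m (s≤s (s≤s z≤n))
    ... | p , pr , p∣m with split-prime pr m (s≤s z≤n)
    ...   | zero , m′ , eq , p∤m′ = contradiction (subst (p ∣_) (≡.trans eq (*-identityˡ m′)) p∣m) p∤m′
    ...   | suc α , m′ , eq , p∤m′ = subst OddSolution (≡.sym eq)
      (odd-step p pr (λ { refl → odd p∣m }) (suc α) p∤m′
        (rec m′<m (λ 2∣m′ → odd (subst (2 ∣_) (≡.sym eq) (∣n⇒∣m*n (p ^ suc α) 2∣m′)))))
      where
      0<m′ : 0 < m′
      0<m′ = n≢0⇒n>0 λ { refl → contradiction (≡.trans eq (*-zeroʳ (p ^ suc α))) λ () }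
      1<p^ : 1 < p ^ suc α
      1<p^ = ≤-trans (nonTrivial⇒n>1 p {{prime⇒nonTrivial pr}})
        (≤-trans (≤-reflexive (≡.sym (*-identityʳ p))) (*-monoʳ-≤ p (m^n>0 p {{prime⇒nonZero pr}} α)))
      m′<m : m′ < m
      m′<m = subst (m′ <_) (≡.sym eq) (≤-trans (+-monoˡ-≤ m′ 0<m′)
        (≤-trans (≤-reflexive (cong (m′ +_) (≡.sym (+-identityʳ m′)))) (*-monoˡ-≤ m′ 1<p^)))

  -- The power of 2 comes last: `odd-solution` supplies `Small`, `One` and `Two` for the odd part,
  -- and `Step` with `w = 0` turns them into `One` for the whole.
  solution : ∀ m → 0 < m → Σ (Model m) λ Q → One (Model.factors Q)
  solution m 0<m with split-prime prime[2] m 0<m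
  ... | α , m′ , eq , 2∤m′ with odd-solution m′ 2∤m′
  ...   | Q , small , one , two = subst (λ m → Σ (Model m) λ Q → One (Model.factors Q)) (≡.sym eq)
    (product-model (coprime-^ prime[2] 2∤m′ α) Q , one-step (LabelledTree.tree full))
    where
    open PrimePart 1 prime[2] α
    open Step (Model.factors Q) 0 small one two

  -- The bridge from pebbling to the order of the group: `element` embeds the `Num` many indices
  -- into it.
  Num≤n : ∀ {m} (Q : Model m) → Num (Model.factors Q) ≤ n
  Num≤n Q = injective⇒≤ {f = λ i → index (Model.element Q (Inverse.to (Index↔ fs) i))}
    (λ eq → Injection.injective (↔⇒↣ (Index↔ fs)) (Model.injective Q (index-injective eq)))
    where fs = Model.factors Q

∏ : ∀ {k} → (Fin k → ℕ) → ℕ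
∏ {zero}  f = 1
∏ {suc k} f = f zero * ∏ (f ∘ suc)

∣∏ : ∀ {k} (f : Fin k → ℕ) i → f i ∣ ∏ f
∣∏ f zero    = m∣m*n (∏ (f ∘ suc))
∣∏ f (suc i) = ∣n⇒∣m*n (f zero) (∣∏ (f ∘ suc) i)

∏>0 : ∀ {k} (f : Fin k → ℕ) → (∀ i → 0 < f i) → 0 < ∏ f
∏>0 {zero}  f h = s≤s z≤n
∏>0 {suc k} f h = *-mono-≤ (h zero) (∏>0 (f ∘ suc) (h ∘ suc))

δ-refl : ∀ {k} (i : Fin k) → δ i i ≡ 1
δ-refl zero    = refl
δ-refl (suc i) = δ-refl i

∑-δ≡1 : ∀ {k} (i : Fin k) → 𝐍.sum (λ j → δ j i) ≡ 1
∑-δ≡1 {suc k} zero    = cong suc (𝐍.sum-0 {k} (λ _ → refl))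
∑-δ≡1 {suc k} (suc i) = ∑-δ≡1 i

positive : ℕ → Bool
positive zero    = false
positive (suc _) = true

-- Pebbles as weighted index sets with sum in a subgroup

module Pebbles {c ℓ} (G : AbelianGroup c ℓ) {n : ℕ} (g : Fin n → AbelianGroup.Carrier G)
               (κ : Fin n → ℕ) (L : ℕ) where
  open AbelianGroup G renaming (refl to ≈-refl; sym to ≈-sym; trans to ≈-trans; reflexive to ≈-reflexive)
  open GroupLemmas G
  open Place
  open Resources (c ⊔ ℓ) n
  open Pebbling affine using (Edge)
  module 𝐆 = CMSum commutativeMonoid
  open SumLemmas commutativeMonoid using () renaming (sum-0 to gsum-0; sum-δ to gsum-δ)

  dot : Resource → Carrier
  dot X = 𝐆.sum (λ i → X i · g i)

  dot-+ : ∀ X Y → dot (λ i → X i + Y i) ≈ dot X ∙ dot Y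
  dot-+ X Y = ≈-trans (𝐆.sum-cong-≋ (λ i → ×-homo-+ (g i) (X i) (Y i)))
                      (𝐆.∑-distrib-+ (λ i → X i · g i) (λ i → Y i · g i))

  dot-subsetSumℕ : ∀ {k} J (f : Fin k → Resource) →
               dot (λ i → subsetSumℕ J (λ j → f j i)) ≈ subsetSum G J (λ j → dot (f j))
  dot-subsetSumℕ {zero}  J f = gsum-0 {n} (λ _ → ≈-refl)
  dot-subsetSumℕ {suc k} J f with J zero
  ... | true  = ≈-trans (dot-+ (f zero) _) (∙-congˡ (dot-subsetSumℕ (J ∘ suc) (f ∘ suc)))
  ... | false = ≈-trans (dot-subsetSumℕ (J ∘ suc) (f ∘ suc)) (≈-sym (identityˡ _))

  cost : Resource → ℕ
  cost X = 𝐍.sum (λ i → X i * κ i)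

  cost-+ : ∀ X Y → cost (λ i → X i + Y i) ≡ cost X + cost Y
  cost-+ X Y = ≡.trans (𝐍.sum-cong-≋ {n} (λ i → *-distribʳ-+ (κ i) (X i) (Y i)))
                       (𝐍.∑-distrib-+ (λ i → X i * κ i) (λ i → Y i * κ i))

  cost-subsetSumℕ : ∀ {k} J (f : Fin k → Resource) →
                cost (λ i → subsetSumℕ J (λ j → f j i)) ≡ subsetSumℕ J (λ j → cost (f j))
  cost-subsetSumℕ {zero}  J f = 𝐍.sum-0 {n} (λ _ → refl)
  cost-subsetSumℕ {suc k} J f with J zero
  ... | true  = ≡.trans (cost-+ (f zero) _) (cong (cost (f zero) +_) (cost-subsetSumℕ (J ∘ suc) (f ∘ suc)))
  ... | false = cost-subsetSumℕ (J ∘ suc) (f ∘ suc)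

  -- L is a common multiple of the orders and κ i = L / ord (g i), so cost X / L is the paper's ∑ 1/|g|.
  pebble : Place → Assertion
  pebble A X = (∃ λ i → 0 < X i) × Mem A (dot X) × order A * cost X ≤ L

  -- The move selects which of the `suc u` pebbles to unite. The union costs no more than all of
  -- them, hence at most `suc u * L` after scaling by `order A`, and the factor `suc u` cancels.
  pebble-edge : ∀ {u A B} → Move u A B → Edge u (pebble A) (pebble B)
  pebble-edge {u} {A} {B} (oA , mv) p with ·-split (suc u) p
  ... | f , f≤X , pf with mv (λ j → dot (f j)) (λ j → proj₁ (proj₂ (pf j)))
  ...   | J , (j , Jj) , mem = Y , (λ i → ≤-trans (subsetSumℕ≤sum J (λ j → f j i)) (f≤X i))
    , (let i , 0<f = proj₁ (pf j) in i , ≤-trans 0<f (≤subsetSumℕ J (λ j → f j i) j Jj))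
    , resp B (≈-sym (dot-subsetSumℕ J f)) mem
    , *-cancelˡ-≤ (suc u) (begin
        suc u * (order B * cost Y)            ≡⟨ *-assoc (suc u) (order B) (cost Y) ⟨
        suc u * order B * cost Y              ≡⟨ cong (_* cost Y) oA ⟨
        order A * cost Y                      ≡⟨ cong (order A *_) (cost-subsetSumℕ J f) ⟩
        order A * subsetSumℕ J (cost ∘ f)         ≤⟨ *-monoʳ-≤ (order A) (subsetSumℕ≤sum J (cost ∘ f)) ⟩
        order A * 𝐍.sum (cost ∘ f)            ≤⟨ sum-bound (cost ∘ f) (order A) L (λ j → proj₂ (proj₂ (pf j))) ⟩
        suc u * L                             ∎)
    where
    open ≤-Reasoning
    Y : Resource
    Y i = subsetSumℕ J (λ j → f j i)

  singleton : ∀ A j → Mem A (g j) → order A * κ j ≤ L → pebble A (δ j)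
  singleton A j mem le = (j , ≤-reflexive (≡.sym (δ-refl j)))
    , resp A (≈-sym (gsum-δ j g)) mem
    , ≤-trans (≤-reflexive (cong (order A *_) (≡.trans
        (𝐍.sum-cong-≋ {n} (λ i → ≡.sym (·≡* (δ j i) (κ i)))) (𝐍.sum-δ j κ)))) le

  -- `positive` forgets multiplicities, so the two sums agree because no index occurs twice.
  dot-01 : ∀ {m} (f : Fin m → Carrier) (X : Fin m → ℕ) → (∀ i → X i ≤ 1) →
           subsetSum G (positive ∘ X) f ≈ 𝐆.sum (λ i → X i · f i)
  dot-01 {zero}  f X h = ≈-refl
  dot-01 {suc m} f X h with X zero | h zero
  ... | zero     | _ = ∙-congˡ (dot-01 (f ∘ suc) (X ∘ suc) (h ∘ suc))
  ... | suc zero | _ = ∙-cong (≈-sym (×-homo-1 _)) (dot-01 (f ∘ suc) (X ∘ suc) (h ∘ suc))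
  ... | suc (suc _) | s≤s ()

  cost-01 : ∀ {m} (f : Fin m → ℕ) (X : Fin m → ℕ) →
            subsetSumℕ (positive ∘ X) f ≤ 𝐍.sum (λ i → X i * f i)
  cost-01 {zero}  f X = z≤n
  cost-01 {suc m} f X with X zero
  ... | zero  = cost-01 (f ∘ suc) (X ∘ suc)
  ... | suc x = +-mono-≤ (m≤m+n (f zero) (x * f zero)) (cost-01 (f ∘ suc) (X ∘ suc))

-- From a pebble at the origin to the subsequence

module Conclusion {c ℓ} (G : AbelianGroup c ℓ) (n : ℕ) (e : Fin n → AbelianGroup.Carrier G)
  (enum : IsEnumeration G n e) (ord : AbelianGroup.Carrier G → ℕ)
  (isOrd : ∀ x → IsOrderOf G x (ord x)) (g : Fin n → AbelianGroup.Carrier G)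
  (L : ℕ) (L>0 : 0 < L) (ord∣L : ∀ x → ord x ∣ L) where
  open AbelianGroup G using (_≈_; ε) renaming (trans to ≈-trans)
  open GroupLemmas G
  open Place
  open FiniteGroup G n e enum ord isOrd

  κ : Fin n → ℕ
  κ i = quotient (ord∣L (g i))

  L≡ : ∀ i → L ≡ κ i * ord (g i)
  L≡ i = _∣_.equality (ord∣L (g i))

  open Resources (c ⊔ ℓ) n
  open Pebbles G g κ L
  open ModelExistence G n e enum ord isOrd affine
  open AffineMonoid affine using (_⟫_)
  open Pebbling affine using (One)
  open Placement affine

  reach-origin : (Q : Model L) → One (Model.factors Q) →
                 ∃ λ X → (∀ i → X i ≤ 1) × pebble (Model.place Q (origin (Model.factors Q))) X
  reach-origin Q one = proj₁ solved , X≤1 , proj₂ (proj₂ solved)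
    where
    fs   = Model.factors Q
    P    = λ v → pebble (Model.place Q v)
    loc  = λ i → Model.locate Q {g i} (kill-∣ (ord-kills (g i)) (ord∣L (g i)))
    placed = place-all fs P (λ i → proj₁ (loc i))

    order≤ : ∀ i → order (Model.place Q (proj₁ (loc i))) * κ i ≤ L
    order≤ i = ≤-trans (*-monoˡ-≤ (κ i) (∣⇒≤ (proj₂ (proj₂ (loc i)) (ord-kills (g i)))))
                       (≤-reflexive (≡.trans (*-comm (ord (g i)) (κ i)) (≡.sym (L≡ i))))

    -- The `n` starting pebbles are the singletons `δ j`, enough by `Num≤n`. Together they use each
    -- index exactly once, whence `X≤1`.
    solved = (proj₂ (proj₂ placed) ⟫ one P
                (map-edges {h = pebble} (λ {u} {A} {B} → pebble-edge {u} {A} {B}) fs (Model.moves Q))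
                (proj₁ placed) (≤-trans (Num≤n Q) (≤-reflexive (≡.sym (proj₁ (proj₂ placed))))))
             (sum-intro δ (λ j → singleton (Model.place Q (proj₁ (loc j))) j (proj₁ (proj₂ (loc j))) (order≤ j)))
    X≤1 : ∀ i → proj₁ solved i ≤ 1
    X≤1 i = ≤-trans (proj₁ (proj₂ solved) i) (≤-reflexive (∑-δ≡1 i))

  module _ (Q : Model L) {X : Resource} (X≤1 : ∀ i → X i ≤ 1)
           (final : pebble (Model.place Q (origin (Model.factors Q))) X) where
    nonempty : ∃ λ i → positive (X i) ≡ true
    nonempty with proj₁ final
    ... | i , 0<X = i , positive-true 0<X
      where
      positive-true : ∀ {m} → 0 < m → positive m ≡ true
      positive-true (s≤s _) = refl

    zero-sum : subsetSum G (positive ∘ X) g ≈ ε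
    zero-sum = ≈-trans (dot-01 g X X≤1) (Model.at-origin Q (proj₁ (proj₂ final)))

    cost≤L : subsetSumℕ (positive ∘ X) κ ≤ L
    cost≤L = ≤-trans (cost-01 κ X) (≤-trans
      (≤-reflexive (≡.trans (≡.sym (*-identityˡ (cost X))) (cong (_* cost X) (≡.sym (Model.order-origin Q)))))
      (proj₂ (proj₂ final)))

    1+pred : suc (pred L) ≡ L
    1+pred = suc-pred L {{>-nonZero L>0}}

    cross≤1 : subsetSumℚ (positive ∘ X) (λ k → recip (ord (g k))) ≤ℚ 1ℚ
    cross≤1 = subsetSumℚ≤1 (pred L) (positive ∘ X) (ord ∘ g) κ
      (λ i → ≡.trans 1+pred (L≡ i)) (≤-trans cost≤L (≤-reflexive (≡.sym 1+pred)))

  conclusion : (Σ (Model L) λ Q → One (Model.factors Q)) →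
    ∃ λ (K : Fin n → Bool) → (∃ λ i → K i ≡ true) × subsetSum G K g ≈ ε
      × (subsetSumℚ K (λ k → recip (ord (g k))) ≤ℚ 1ℚ)
  conclusion (Q , one) with reach-origin Q one
  ... | X , X≤1 , final = positive ∘ X , nonempty Q X≤1 final , zero-sum Q X≤1 final , cross≤1 Q X≤1 final

theorem2 : ∀ {c ℓ : Level} (G : AbelianGroup c ℓ) (n : ℕ)
    (e : Fin n → AbelianGroup.Carrier G) → IsEnumeration G n e
    → (ord : AbelianGroup.Carrier G → ℕ) → (∀ x → IsOrderOf G x (ord x))
    → (g : Fin n → AbelianGroup.Carrier G)
    → ∃ λ (K : Fin n → Bool)
    → (∃ λ i → K i ≡ true)
    × AbelianGroup._≈_ G (subsetSum G K g) (AbelianGroup.ε G)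
    × (subsetSumℚ K (λ k → recip (ord (g k))) ≤ℚ 1ℚ)
theorem2 {c} {ℓ} G n e enum ord isOrd g = conclusion (solution L L>0)
  where
  open FiniteGroup G n e enum ord isOrd
  -- As a common multiple of all orders, `L` has two uses: its torsion is the whole group, and it is
  -- the common denominator of the reciprocals.
  L = ∏ (ord ∘ e)
  L>0 : 0 < L
  L>0 = ∏>0 (ord ∘ e) (λ i → ord>0 (e i))
  ord∣L : ∀ x → ord x ∣ L
  ord∣L x = subst (_∣ L) (ord-cong (e-index x)) (∣∏ (ord ∘ e) (index x))
  open Conclusion G n e enum ord isOrd g L L>0 ord∣L
  open ModelExistence G n e enum ord isOrd (Resources.affine (c ⊔ ℓ) n)
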